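{- There is a polynomial-time algorithm that solves the Strong Geodetic Recognition problem for cactus graphs: given a cactus graph $G=(V,E)$ and a set $X\subseteq V$, it decides whether $X$ is a strong geodetic set of $G$.
   Context: All graphs are finite, simple, undirected and connected. A cactus graph is a connected graph in which every edge belongs to at most one simple cycle. A shortest path assignment $I(S)$ of a vertex set $S\subseteq V(G)$ consists of exactly one chosen shortest path of $G$ between $u$ and $v$ for each unordered pair of distinct vertices $u,v\in S$. The set $S$ is a strong geodetic set of $G$ if there is a shortest path assignment $I(S)$ such that every vertex of $V(G)\setminus S$ lies on some path of $I(S)$ (for $|S|\ge 2$ this is the same as $\bigcup_{P\in I(S)}V(P)=V(G)$). -}

module Defs where

open import Data.Bool.Base using (Bool; true; false; T; if_then_else_)
open import Data.Fin.Base using (Fin; _<_)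
open import Data.Fin.Subset using (Subset; _∈_; _∉_)
open import Data.List.Base
  using (List; []; _∷_; _++_; length; replicate; tabulate; concat)
open import Data.List.Membership.Propositional using () renaming (_∈_ to _∈ₗ_)
open import Data.List.Relation.Unary.Unique.Propositional using (Unique)
open import Data.Maybe.Base using (Maybe; just; nothing)
open import Data.Nat.Base using (ℕ; zero; suc; _+_; _*_; _∸_; _^_; _≤_; _≡ᵇ_; NonZero)
open import Data.Product.Base using (Σ-syntax; ∃-syntax; _×_; _,_)
open import Data.Sum.Base using (_⊎_; inj₁; inj₂)
import Data.Vec.Base as Vec
open import Function.Bundles using (_⇔_)
open import Relation.Binary.Construct.Closure.ReflexiveTransitive using (Star; ε; _◅_)
open import Relation.Binary.PropositionalEquality.Core using (_≡_)
open import Relation.Nullary.Decidable.Core using (Dec; does)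

------------------------------------------------------------------------
-- Graphs

record Graph (n : ℕ) : Set where
  field
    adj       : Fin n → Fin n → Bool
    symmetric : ∀ u v → adj u v ≡ adj v u
    loopless  : ∀ v → adj v v ≡ false

  Adj : Fin n → Fin n → Set
  Adj u v = T (adj u v)

module _ {n : ℕ} (G : Graph n) where

  open Graph G

  Walk : Fin n → Fin n → Set
  Walk = Star Adj

  vertices : ∀ {u v} → Walk u v → List (Fin n)
  vertices {u} ε       = u ∷ []
  vertices {u} (_ ◅ w) = u ∷ vertices w

  -- The edges in the order, and with the orientation, in which they are
  -- traversed.
  steps : ∀ {u v} → Walk u v → List (Fin n × Fin n)
  steps ε                     = []
  steps (_◅_ {u} {v} {_} _ w) = (u , v) ∷ steps w

  walkLength : ∀ {u v} → Walk u v → ℕ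
  walkLength w = length (steps w)

  IsPath : ∀ {u v} → Walk u v → Set
  IsPath w = Unique (vertices w)

  -- The null graph does not count as connected.
  Connected : Set
  Connected = NonZero n × (∀ u v → Walk u v)

  -- A simple cycle is given by one of its edges together with a path
  -- of length at least two that leads back from the end of this edge to
  -- its start.  The same cycle therefore has several representations,
  -- one for each choice of the edge and of the direction; they are
  -- identified by _≈ᶜ_.
  record Cycle : Set where
    field
      {start next} : Fin n
      edge         : Adj start next
      back         : Walk next start
      back-isPath  : IsPath back
      back-long    : 2 ≤ walkLength back

    closedWalk : Walk start start
    closedWalk = edge ◅ back

  -- The unordered pair {a, b} is an edge of the cycle.
  HasEdge : Cycle → Fin n → Fin n → Set
  HasEdge C a b = (a , b) ∈ₗ steps closedWalk ⊎ (b , a) ∈ₗ steps closedWalk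
    where open Cycle C

  _≈ᶜ_ : Cycle → Cycle → Set
  C ≈ᶜ D = ∀ a b → HasEdge C a b ⇔ HasEdge D a b

  IsCactus : Set
  IsCactus =
    Connected × (∀ a b (C D : Cycle) → HasEdge C a b → HasEdge D a b → C ≈ᶜ D)

  record ShortestPath (u v : Fin n) : Set where
    field
      walk     : Walk u v
      isPath   : IsPath walk
      shortest : ∀ (w : Walk u v) → IsPath w → walkLength walk ≤ walkLength w

  -- The unordered pair {u, v} of distinct vertices is represented by
  -- its increasing enumeration.
  Assignment : Subset n → Set
  Assignment S = ∀ u v → u ∈ S → v ∈ S → u < v → ShortestPath u v

  IsStrongGeodetic : Subset n → Set
  IsStrongGeodetic S = Σ[ I ∈ Assignment S ] ∀ x → x ∉ S →
    ∃[ u ] ∃[ v ] Σ[ u∈S ∈ u ∈ S ] Σ[ v∈S ∈ v ∈ S ] Σ[ u<v ∈ u < v ]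
      x ∈ₗ vertices (ShortestPath.walk (I u v u∈S v∈S u<v))

------------------------------------------------------------------------
-- Random access machines (Cook and Reckhow), with unit costs.  Since no
-- instruction multiplies, t steps produce numbers of O(t) bits only, so
-- polynomial time here is polynomial time on Turing machines.

data Instruction : Set where
  const         : (i c : ℕ) → Instruction     -- Xᵢ ← c
  add           : (i j k : ℕ) → Instruction   -- Xᵢ ← Xⱼ + Xₖ
  sub           : (i j k : ℕ) → Instruction   -- Xᵢ ← max (Xⱼ − Xₖ) 0
  load          : (i j : ℕ) → Instruction     -- Xᵢ ← X_{Xⱼ}
  store         : (i j : ℕ) → Instruction     -- X_{Xᵢ} ← Xⱼ
  jump          : (j m : ℕ) → Instruction     -- if Xⱼ > 0 go to instruction m
  read          : (i : ℕ) → Instruction       -- Xᵢ ← next input symbol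
  accept reject : Instruction

Program : Set
Program = List Instruction

Memory : Set
Memory = ℕ → ℕ

_[_≔_] : Memory → ℕ → ℕ → Memory
(X [ i ≔ x ]) j = if j ≡ᵇ i then x else X j

record Configuration : Set where
  constructor ⟨_,_,_⟩
  field
    counter : ℕ
    memory  : Memory
    input   : List Bool

-- Control leaving the program rejects.
fetch : Program → ℕ → Instruction
fetch []      _       = reject
fetch (i ∷ _) zero    = i
fetch (_ ∷ p) (suc m) = fetch p m

-- Reading past the end of the input yields the end marker 2.
symbol : List Bool → ℕ
symbol []          = 2
symbol (false ∷ _) = 0
symbol (true ∷ _)  = 1

rest : List Bool → List Bool
rest []      = []
rest (_ ∷ w) = w

-- The result is the next configuration or, on halting, the answer.
execute : Instruction → Configuration → Configuration ⊎ Bool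
execute (const i c) ⟨ pc , X , w ⟩ = inj₁ ⟨ suc pc , X [ i ≔ c ] , w ⟩
execute (add i j k) ⟨ pc , X , w ⟩ = inj₁ ⟨ suc pc , X [ i ≔ X j + X k ] , w ⟩
execute (sub i j k) ⟨ pc , X , w ⟩ = inj₁ ⟨ suc pc , X [ i ≔ X j ∸ X k ] , w ⟩
execute (load i j)  ⟨ pc , X , w ⟩ = inj₁ ⟨ suc pc , X [ i ≔ X (X j) ] , w ⟩
execute (store i j) ⟨ pc , X , w ⟩ = inj₁ ⟨ suc pc , X [ X i ≔ X j ] , w ⟩
execute (jump j m)  ⟨ pc , X , w ⟩ =
  inj₁ ⟨ (if X j ≡ᵇ 0 then suc pc else m) , X , w ⟩
execute (read i)    ⟨ pc , X , w ⟩ = inj₁ ⟨ suc pc , X [ i ≔ symbol w ] , rest w ⟩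
execute accept      _              = inj₂ true
execute reject      _              = inj₂ false

step : Program → Configuration → Configuration ⊎ Bool
step p c = execute (fetch p (Configuration.counter c)) c

initial : List Bool → Configuration
initial w = ⟨ 0 , (λ _ → 0) , w ⟩

-- The answer of the program if it halts within t steps.
runFor : ℕ → Program → Configuration → Maybe Bool
runFor zero    p c = nothing
runFor (suc t) p c with step p c
... | inj₁ c′ = runFor t p c′
... | inj₂ b  = just b

------------------------------------------------------------------------
-- Decision problems

-- The inputs are promised to encode an instance.
record DecisionProblem : Set₁ where
  field
    Instance : Set
    encode   : Instance → List Bool
    Yes      : Instance → Set

-- The answer has to be correct: it is the Boolean of a decision of Yes x.
Decides_within_ : Program → (ℕ → ℕ) → DecisionProblem → Set
(Decides p within time) Π = ∀ (x : Instance) → Σ[ d ∈ Dec (Yes x) ]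
  runFor (time (length (encode x))) p (initial (encode x)) ≡ just (does d)
  where open DecisionProblem Π

PolynomialTimeDecidable : DecisionProblem → Set
PolynomialTimeDecidable Π =
  ∃[ p ] ∃[ c ] ∃[ k ] (Decides p within λ ℓ → c * ℓ ^ k + c) Π

------------------------------------------------------------------------
-- Strong Geodetic Recognition

record CactusWithSubset : Set where
  field
    {order} : ℕ
    graph   : Graph order
    cactus  : IsCactus graph
    subset  : Subset order

-- The order n in unary, the n × n adjacency matrix row by row, and the
-- characteristic vector of the subset.
encodeGraphWithSubset : ∀ {n} → Graph n → Subset n → List Bool
encodeGraphWithSubset {n} G X =
  replicate n true ++ false ∷
  concat (tabulate λ u → tabulate λ v → Graph.adj G u v) ++
  Vec.toList X

StrongGeodeticRecognitionOnCacti : DecisionProblem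
StrongGeodeticRecognitionOnCacti = record
  { Instance = CactusWithSubset
  ; encode   = λ x → encodeGraphWithSubset (graph x) (subset x)
  ; Yes      = λ x → IsStrongGeodetic (graph x) (subset x)
  }
  where open CactusWithSubset

{-# OPTIONS --safe #-}

-- In a cactus with n vertices, X is a strong geodetic set if and only if X
-- contains every vertex, or X has at least three elements and every other
-- vertex lies on some geodesic between two of them, or two elements of X
-- are at distance at least n - 1.
--
-- In the second case, start from an arbitrary choice of shortest paths.  Let
-- x be an uncovered vertex on a geodesic Q between u and v in X, let P be the
-- chosen path from u to v, and replace the part of P between its last meeting
-- with Q before x and the first one after x by the corresponding part of Q.
-- These two parts form a cycle, and no edge of a cactus lies on a second
-- cycle, so deleting x and any vertex y of the replaced part separates u
-- from v.  Given a third element w of X, the chosen paths between u and w and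
-- between w and v avoid x, hence they pass through y: by the rerouting x is
-- covered and no vertex is lost.
--
-- This criterion is a first-order formula over the table of the pairs of
-- vertices joined by a walk of length at most k, for k < n.  Formulas with
-- bounded quantifiers are evaluated as arithmetical expressions with bounded
-- sums, the value 0 standing for truth, and sums are compiled to loops.
module Submission where

open import Defs
open import Data.Bool.Base using (Bool; true; false; T; if_then_else_)
open import Data.Bool.Properties using (T?)
open import Data.Empty using (⊥; ⊥-elim)
open import Data.Fin.Base as Fin using (Fin; toℕ; fromℕ<)
import Data.Fin.Properties as Fin
open import Data.Fin.Subset using (Subset; _∈_; _∉_)
open import Data.Fin.Subset.Properties using (_∈?_)
open import Data.List.Base as List
  using (List; []; _∷_; _++_; length; replicate; tabulate; concat; allFin)
import Data.List.Membership.DecPropositional as DecMembership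
open import Data.List.Membership.Propositional
  using () renaming (_∈_ to _∈ₗ_; _∉_ to _∉ₗ_)
open import Data.List.Membership.Propositional.Properties using (∈-lookup; ∈-allFin)
open import Data.List.Properties using (length-++; length-replicate; length-tabulate; ++-assoc)
open import Data.List.Relation.Unary.All as All using ([]; _∷_)
import Data.List.Relation.Unary.All.Properties as All
open import Data.List.Relation.Unary.AllPairs using ([]; _∷_)
open import Data.List.Relation.Unary.Any using (here; there; index)
open import Data.List.Relation.Unary.Any.Properties using (lookup-index)
open import Data.List.Relation.Unary.Unique.Propositional using (Unique)
open import Data.Maybe.Base using (just)
open import Data.Nat.Base
open import Data.Nat.Properties
open import Data.Nat.Solver using (module +-*-Solver)
open import Data.Product.Base using (Σ-syntax; ∃-syntax; _×_; _,_; proj₁; proj₂)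
open import Data.Product.Function.NonDependent.Propositional using (_×-⇔_)
open import Data.Sum.Base as Sum using (_⊎_; inj₁; inj₂)
open import Data.Sum.Function.Propositional using (_⊎-⇔_)
open import Data.Unit.Base using (⊤; tt)
open import Data.Vec.Base as Vec using (Vec; []; _∷_; lookup)
open import Data.Vec.Properties using (length-toList; lookup⇒[]=; []=⇒lookup)
open import Data.Vec.Properties.WithK using ([]=-irrelevant)
open import Function.Base using (_∘_; id)
open import Function.Bundles using (_⇔_; mk⇔; Equivalence)
open import Function.Construct.Composition using (_⇔-∘_)
open import Function.Related.TypeIsomorphisms using (→-cong-⇔; ¬-cong-⇔)
open import Relation.Binary.Construct.Closure.ReflexiveTransitive as Star
  using (Star; ε; _◅_; _◅◅_)
open import Relation.Binary.Definitions using (tri<; tri≈; tri>)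
open import Relation.Binary.PropositionalEquality
open import Relation.Nullary using (¬_; Dec; yes; no; contradiction)
open import Relation.Nullary.Decidable using (map; map′; _×-dec_; _⊎-dec_; ¬?)

open Equivalence using (to; from)

-- Walks and geodesics in cacti

-- A geodesic is treated as a sequence of vertices indexed by the distance from its start. Two
-- geodesics with the same ends can share a vertex only at equal indices, so P and Q are compared
-- index by index, and swapping a segment between two meeting indices preserves the length. The
-- third element of X is what makes a swap harmless. If X consists of two vertices only, a single
-- path has to visit everything, whence the separate condition with n - 1. Every swap enlarges the
-- covered set, so one pass over the vertices ends with all of them covered. A shortest path has
-- fewer than n edges, which bounds the quantifiers over lengths. The formulas have no recursion;
-- the recursion needed for distances is carried by the order in which the table is filled, each
-- cell being described by one fixed formula over the earlier cells. As all formulas are fixed, sums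
-- are nested to a fixed depth with polynomially bounded ranges, and this yields the polynomial
-- running time.

module Walks {n : ℕ} (G : Graph n) where

  open Graph G
  open DecMembership (Fin._≟_ {n}) public using () renaming (_∈?_ to _∈ₗ?_)

  adj-sym : ∀ {u v} → Adj u v → Adj v u
  adj-sym {u} {v} = subst T (symmetric u v)

  adj⇒≢ : ∀ {u v} → Adj u v → u ≢ v
  adj⇒≢ {u} a refl = subst T (loopless u) a

  unique-∷ : ∀ {x : Fin n} {xs} → x ∉ₗ xs → Unique xs → Unique (x ∷ xs)
  unique-∷ x∉xs xs! = All.¬Any⇒All¬ _ x∉xs ∷ xs!

  start∈ : ∀ {u v} (w : Walk G u v) → u ∈ₗ vertices G w
  start∈ ε       = here refl
  start∈ (_ ◅ _) = here refl

  end∈ : ∀ {u v} (w : Walk G u v) → v ∈ₗ vertices G w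
  end∈ ε       = here refl
  end∈ (_ ◅ w) = there (end∈ w)

  walkLength-◅◅ : ∀ {u v x} (w : Walk G u v) (w′ : Walk G v x) →
                  walkLength G (w ◅◅ w′) ≡ walkLength G w + walkLength G w′
  walkLength-◅◅ ε       w′ = refl
  walkLength-◅◅ (_ ◅ w) w′ = cong suc (walkLength-◅◅ w w′)

  walkLength≡0 : ∀ {u v} (w : Walk G u v) → walkLength G w ≤ 0 → u ≡ v
  walkLength≡0 ε _ = refl

  length-vertices : ∀ {u v} (w : Walk G u v) → length (vertices G w) ≡ suc (walkLength G w)
  length-vertices ε       = refl
  length-vertices (_ ◅ w) = cong suc (length-vertices w)

  -- The steps and the path property are recorded for the second part alone: it is the part that
  -- survives when a loop at x is cut off.
  split : ∀ {u v x} (w : Walk G u v) → x ∈ₗ vertices G w →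
          Σ[ a ∈ Walk G u x ] Σ[ b ∈ Walk G x v ]
            walkLength G a + walkLength G b ≡ walkLength G w ×
            (∀ {s} → s ∈ₗ steps G b → s ∈ₗ steps G w) ×
            (IsPath G w → IsPath G b)
  split ε       (here refl) = ε , ε , refl , id , id
  split w@(_ ◅ _) (here refl) = ε , w , refl , id , id
  split (e ◅ w) (there x∈)  with a , b , l , s , p ← split w x∈ =
    e ◅ a , b , cong suc l , there ∘ s , λ { (_ ∷ q) → p q }

  loopErase : ∀ {u v} (w : Walk G u v) → Σ[ w′ ∈ Walk G u v ]
    IsPath G w′ × walkLength G w′ ≤ walkLength G w ×
    (∀ {s} → s ∈ₗ steps G w′ → s ∈ₗ steps G w)
  loopErase ε = ε , [] ∷ [] , z≤n , id
  loopErase {u} (e ◅ w) with loopErase w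
  ... | w′ , p , l , s with u ∈ₗ? vertices G w′
  ...   | no u∉ = e ◅ w′ , unique-∷ u∉ p , s≤s l ,
                  λ { (here q) → here q ; (there q) → there (s q) }
  ...   | yes u∈ with _ , b , l′ , s′ , p′ ← split w′ u∈ =
    b , p′ p , m≤n⇒m≤1+n (≤-trans (≤-trans (m≤n+m _ _) (≤-reflexive l′)) l) , there ∘ s ∘ s′

  -- If the first vertex recurred, the walk from its recurrence on would be strictly shorter.
  shortest⇒path : ∀ {u v} (w : Walk G u v) →
                  (∀ (w′ : Walk G u v) → walkLength G w ≤ walkLength G w′) → IsPath G w
  shortest⇒path ε       min = [] ∷ []
  shortest⇒path {u} (e ◅ w) min with u ∈ₗ? vertices G w
  ... | no u∉ = unique-∷ u∉ (shortest⇒path w λ w′ → s≤s⁻¹ (min (e ◅ w′)))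
  ... | yes u∈ with _ , b , l , _ ← split w u∈ =
    contradiction (min b) (<⇒≱ (s≤s (≤-trans (m≤n+m _ _) (≤-reflexive l))))

  forget : ∀ {R : Fin n → Fin n → Set} → (∀ {s t} → R s t → Adj s t) →
           ∀ {u v} → Star R u v → Walk G u v
  forget R⇒adj = Star.map R⇒adj

  forget-steps : ∀ {R : Fin n → Fin n → Set} (R⇒adj : ∀ {s t} → R s t → Adj s t) →
                 ∀ {u v a b} (w : Star R u v) → (a , b) ∈ₗ steps G (forget R⇒adj w) → R a b
  forget-steps R⇒adj (r ◅ w) (here refl) = r
  forget-steps R⇒adj (r ◅ w) (there s)   = forget-steps R⇒adj w s

  along : ∀ {R : Fin n → Fin n → Set} m (f : ℕ → Fin n) →
          (∀ i → i < m → R (f i) (f (suc i))) → Star R (f 0) (f m)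
  along zero    f r = ε
  along (suc m) f r = r 0 z<s ◅ along m (f ∘ suc) (λ i i<m → r (suc i) (s≤s i<m))

  along-length : ∀ m (f : ℕ → Fin n) (r : ∀ i → i < m → Adj (f i) (f (suc i))) →
                 walkLength G (along m f r) ≡ m
  along-length zero    f r = refl
  along-length (suc m) f r = cong suc (along-length m (f ∘ suc) _)

  along-∈ : ∀ m (f : ℕ → Fin n) (r : ∀ i → i < m → Adj (f i) (f (suc i))) →
            ∀ i → i ≤ m → f i ∈ₗ vertices G (along m f r)
  along-∈ m f r zero i≤m = start∈ (along m f r)
  along-∈ (suc m) f r (suc i) (s≤s i≤m) = there (along-∈ m (f ∘ suc) _ i i≤m)

  position : ∀ {u v} → Walk G u v → ℕ → Fin n
  position {u} ε       _       = u
  position {u} (_ ◅ _) zero    = u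
  position     (_ ◅ w) (suc i) = position w i

  position-start : ∀ {u v} (w : Walk G u v) → position w 0 ≡ u
  position-start ε       = refl
  position-start (_ ◅ _) = refl

  position-end : ∀ {u v} (w : Walk G u v) → position w (walkLength G w) ≡ v
  position-end ε       = refl
  position-end (_ ◅ w) = position-end w

  position-adj : ∀ {u v} (w : Walk G u v) i → i < walkLength G w →
                 Adj (position w i) (position w (suc i))
  position-adj (e ◅ w) zero    _       = subst (Adj _) (sym (position-start w)) e
  position-adj (_ ◅ w) (suc i) (s≤s l) = position-adj w i l

  position-∈ : ∀ {u v} (w : Walk G u v) i → position w i ∈ₗ vertices G w
  position-∈ ε       i       = here refl
  position-∈ (_ ◅ w) zero    = here refl
  position-∈ (_ ◅ w) (suc i) = there (position-∈ w i)

  ∈-position : ∀ {u v x} (w : Walk G u v) → x ∈ₗ vertices G w →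
               ∃[ i ] i ≤ walkLength G w × position w i ≡ x
  ∈-position ε       (here refl) = 0 , z≤n , refl
  ∈-position (_ ◅ w) (here refl) = 0 , z≤n , refl
  ∈-position (_ ◅ w) (there x∈) with i , l , eq ← ∈-position w x∈ = suc i , s≤s l , eq

  position-◅◅ : ∀ {u x v} (a : Walk G u x) (b : Walk G x v) →
                position (a ◅◅ b) (walkLength G a) ≡ x
  position-◅◅ ε       b = position-start b
  position-◅◅ (_ ◅ a) b = position-◅◅ a b

  avoiding : ∀ {P : Fin n → Set} {u v} (w : Walk G u v) → (∀ {z} → z ∈ₗ vertices G w → P z) →
             Star (λ s t → Adj s t × P s × P t) u v
  avoiding ε       p = ε
  avoiding (e ◅ w) p = (e , p (here refl) , p (there (start∈ w))) ◅ avoiding w (p ∘ there)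

  -- The path grows at its front by f 1, f 2 and so on, hence the result traverses f by decreasing
  -- index before it follows w. The information about its vertices serves to check disjointness when
  -- the next arc of a cycle is attached.
  prolong : ∀ m (f : ℕ → Fin n) {r s t} → f 0 ≡ s → f m ≡ r →
            (w : Walk G s t) → IsPath G w →
            (∀ i → i < m → Adj (f (suc i)) (f i)) →
            (∀ i k → i < k → k ≤ m → f i ≢ f k) →
            (∀ i → 0 < i → i ≤ m → f i ∉ₗ vertices G w) →
            Σ[ w′ ∈ Walk G r t ] IsPath G w′ ×
              (∀ {z} → z ∈ₗ vertices G w′ →
                 z ∈ₗ vertices G w ⊎ ∃[ i ] 0 < i × i ≤ m × z ≡ f i) ×
              (∀ {z} → z ∈ₗ vertices G w → z ∈ₗ vertices G w′) ×
              (∀ i → i ≤ m → f i ∈ₗ vertices G w′)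
  prolong zero f refl refl w p adj inj fresh = w , p , inj₁ , id , λ { zero _ → start∈ w }
  prolong (suc m) f f0 refl w p adj inj fresh
    with w′ , p′ , only , keeps , has ← prolong m f f0 refl w p
           (λ i i<m → adj i (m≤n⇒m≤1+n i<m)) (λ i k i<k k≤m → inj i k i<k (m≤n⇒m≤1+n k≤m))
           (λ i 0<i i≤m → fresh i 0<i (m≤n⇒m≤1+n i≤m)) =
    adj m ≤-refl ◅ w′ , unique-∷ (new only) p′ , only′ only , there ∘ keeps , has′ has
    where
    Old : Fin n → Set
    Old z = z ∈ₗ vertices G w ⊎ ∃[ i ] 0 < i × i ≤ m × z ≡ f i
    new : ∀ {zs} → (∀ {z} → z ∈ₗ zs → Old z) → f (suc m) ∉ₗ zs
    new only z∈ with only z∈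
    ... | inj₁ z∈w = fresh (suc m) z<s ≤-refl z∈w
    ... | inj₂ (i , _ , i≤m , eq) = inj i (suc m) (s≤s i≤m) ≤-refl (sym eq)
    only′ : ∀ {zs} → (∀ {z} → z ∈ₗ zs → Old z) → ∀ {z} → z ∈ₗ f (suc m) ∷ zs →
            z ∈ₗ vertices G w ⊎ ∃[ i ] 0 < i × i ≤ suc m × z ≡ f i
    only′ only (here eq)  = inj₂ (suc m , z<s , ≤-refl , eq)
    only′ only (there z∈) =
      Sum.map₂ (λ (i , 0<i , i≤m , eq) → i , 0<i , m≤n⇒m≤1+n i≤m , eq) (only z∈)
    has′ : ∀ {zs} → (∀ i → i ≤ m → f i ∈ₗ zs) → ∀ i → i ≤ suc m → f i ∈ₗ f (suc m) ∷ zs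
    has′ has i i≤1+m with m≤n⇒m<n∨m≡n i≤1+m
    ... | inj₁ (s≤s i≤m) = there (has i i≤m)
    ... | inj₂ refl      = here refl

  record Geodesic (u v : Fin n) (d : ℕ) : Set where
    field
      at       : ℕ → Fin n
      at-start : at 0 ≡ u
      at-end   : at d ≡ v
      at-adj   : ∀ i → i < d → Adj (at i) (at (suc i))
      minimal  : ∀ (w : Walk G u v) → d ≤ walkLength G w

  open Geodesic

  -- If l > k, then following P up to the common vertex and Q from there on
  -- would be a shortcut.
  same-level-≤ : ∀ {u v d} (P Q : Geodesic u v d) {k l} → k ≤ d → l ≤ d →
                 at P k ≡ at Q l → l ≤ k
  same-level-≤ {d = d} P Q {k} {l} k≤d l≤d eq = +-cancelʳ-≤ (d ∸ l) l k (begin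
    l + (d ∸ l)       ≡⟨ m+[n∸m]≡n l≤d ⟩
    d                 ≤⟨ minimal′ (at-start P) (trans (cong (at Q) (m∸n+n≡m l≤d)) (at-end Q))
                           (first ◅◅ subst (λ z → Walk G z _) (sym eq) second) ⟩
    _                 ≡⟨ walkLength-◅◅ first _ ⟩
    walkLength G first + _ ≡⟨ cong₂ _+_ (along-length k (at P) _) (second-length eq) ⟩
    k + (d ∸ l)       ∎)
    where
    open ≤-Reasoning
    minimal′ : ∀ {a b} → a ≡ _ → b ≡ _ → (w : Walk G a b) → d ≤ walkLength G w
    minimal′ refl refl = minimal P
    first : Walk G (at P 0) (at P k)
    first = along k (at P) (λ i i<k → at-adj P i (<-≤-trans i<k k≤d))
    r : ∀ i → i < d ∸ l → Adj (at Q (i + l)) (at Q (suc i + l))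
    r i i<d∸l = at-adj Q (i + l) (subst (i + l <_) (m∸n+n≡m l≤d) (+-monoˡ-< l i<d∸l))
    second : Walk G (at Q l) (at Q (d ∸ l + l))
    second = along (d ∸ l) (λ i → at Q (i + l)) r
    second-length : ∀ {z} (e : z ≡ at Q l) →
      walkLength G (subst (λ z → Walk G z _) (sym e) second) ≡ d ∸ l
    second-length refl = along-length (d ∸ l) (λ i → at Q (i + l)) r

  same-level : ∀ {u v d} (P Q : Geodesic u v d) {k l} → k ≤ d → l ≤ d →
               at P k ≡ at Q l → k ≡ l
  same-level P Q k≤d l≤d eq =
    ≤-antisym (same-level-≤ Q P l≤d k≤d (sym eq)) (same-level-≤ P Q k≤d l≤d eq)

  geodesic : ∀ {u v d} (w : Walk G u v) → walkLength G w ≡ d →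
             (∀ (w′ : Walk G u v) → d ≤ walkLength G w′) → Geodesic u v d
  geodesic w eq min = record
    { at = position w ; at-start = position-start w
    ; at-end = trans (cong (position w) (sym eq)) (position-end w)
    ; at-adj = λ i i<d → position-adj w i (subst (i <_) (sym eq) i<d) ; minimal = min }

  module Cactus (cactus : IsCactus G) where

    -- Every walk b ⇝ a that avoids the edge {a , b} contains a path that
    -- closes the cycle through this edge, and there is only one such cycle.
    cycle-vertex-unavoidable : ∀ {a b y} → Adj a b → y ≢ a → y ≢ b →
      (w : Walk G b a) → IsPath G w → y ∈ₗ vertices G w →
      Star (λ s t → Adj s t × ((s ≢ y × t ≢ y) × ¬ (s ≡ a × t ≡ b) × ¬ (s ≡ b × t ≡ a))) b a → ⊥
    cycle-vertex-unavoidable {a} {b} {y} a~b y≢a y≢b w w-path y∈w w′ =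
      -- `C` has an edge at y. As `C` and `D` share the edge {a , b}, they have the same edges, but
      -- `D` avoids y.
      excluded (to (proj₂ cactus a b C D (inj₁ (here refl)) (inj₁ (here refl)) _ _)
                 (proj₂ C-edge))
      where
      C-long : ∀ {b} → y ≢ b → (w : Walk G b a) → y ∈ₗ vertices G w → 2 ≤ walkLength G w
      C-long y≢b ε           (here y≡a)         = contradiction y≡a y≢a
      C-long y≢b (_ ◅ ε)     (here y≡b)         = contradiction y≡b y≢b
      C-long y≢b (_ ◅ ε)     (there (here y≡a)) = contradiction y≡a y≢a
      C-long y≢b (_ ◅ _ ◅ _) _                  = s≤s (s≤s z≤n)

      C : Cycle G
      C = record { edge = a~b ; back = w ; back-isPath = w-path ; back-long = C-long y≢b w y∈w }

      step-at : ∀ {b} (w : Walk G b a) → y ∈ₗ vertices G w → ∃[ z ] (y , z) ∈ₗ steps G w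
      step-at ε       (here y≡a)   = contradiction y≡a y≢a
      step-at (_ ◅ _) (here refl)  = _ , here refl
      step-at (_ ◅ w) (there y∈)   with z , s ← step-at w y∈ = z , there s

      C-edge : ∃[ z ] HasEdge G C y z
      C-edge with z , s ← step-at w y∈w = z , inj₁ (there s)

      erased = loopErase (forget proj₁ w′)

      Q : Fin n → Fin n → Set
      Q s t = (s ≢ y × t ≢ y) × ¬ (s ≡ a × t ≡ b) × ¬ (s ≡ b × t ≡ a)

      D-steps : ∀ {s t} → (s , t) ∈ₗ steps G (proj₁ erased) → Q s t
      D-steps = proj₂ ∘ forget-steps proj₁ w′ ∘ proj₂ (proj₂ (proj₂ erased))

      -- Length 0 would make the adjacent vertices a and b equal, and length 1 would use the step
      -- from b to a, which `Q` forbids.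
      D-long : ∀ (w : Walk G b a) → (∀ {s t} → (s , t) ∈ₗ steps G w → Q s t) → 2 ≤ walkLength G w
      D-long ε           q = contradiction refl (adj⇒≢ a~b)
      D-long (_ ◅ ε)     q = contradiction (refl , refl) (proj₂ (proj₂ (q (here refl))))
      D-long (_ ◅ _ ◅ _) q = s≤s (s≤s z≤n)

      D : Cycle G
      D = record { edge = a~b ; back = proj₁ erased ; back-isPath = proj₁ (proj₂ erased)
                 ; back-long = D-long _ D-steps }

      excluded : ∀ {z} → ¬ HasEdge G D y z
      excluded (inj₁ (here refl)) = y≢a refl
      excluded (inj₁ (there s))   = proj₁ (proj₁ (D-steps s)) refl
      excluded (inj₂ (here refl)) = y≢b refl
      excluded (inj₂ (there s))   = proj₂ (proj₁ (D-steps s)) refl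

    module _ {u v d} (P Q : Geodesic u v d) {i₁ i₂ i j : ℕ}
      (i₁<i : i₁ < i) (i<i₂ : i < i₂) (i₁<j : i₁ < j) (j<i₂ : j < i₂) (i₂≤d : i₂ ≤ d)
      (meet₁ : at P i₁ ≡ at Q i₁) (meet₂ : at P i₂ ≡ at Q i₂)
      (apart : ∀ k → i₁ < k → k < i₂ → at P k ≢ at Q k) where

      private
        x x⁺ y : Fin n
        x  = at Q j
        x⁺ = at Q (suc j)
        y  = at P i

        j<d : j < d
        j<d = <-≤-trans j<i₂ i₂≤d

        levelQ : ∀ {k l} → k ≤ d → l ≤ d → at Q k ≡ at Q l → k ≡ l
        levelQ = same-level Q Q

        -- By `same-level`, Q could reach y only at index i, where P and Q differ.
        y∉Q : ∀ {k} → k ≤ d → at Q k ≢ y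
        y∉Q {k} k≤d eq = apart i i₁<i i<i₂ (trans (sym eq) (cong (at Q) k≡i))
          where
          k≡i : k ≡ i
          k≡i = same-level Q P k≤d (<⇒≤ (<-≤-trans i<i₂ i₂≤d)) eq

        -- The cycle through x and y without its edge {x , x⁺} is traversed
        -- from x⁺ to x by going along f₃, f₂ and f₁ in the direction of
        -- decreasing indices.
        f₁ f₂ f₃ : ℕ → Fin n
        f₁ k = at Q (j ∸ k)
        f₂ k = at P (k + i₁)
        f₃ k = at Q (i₂ ∸ k)

        ∸-step : ∀ {m k} → k < m → suc (m ∸ suc k) ≡ m ∸ k
        ∸-step {suc m} {k} (s≤s k≤m) = sym (+-∸-assoc 1 k≤m)

        OnQ OnP : Fin n → Set
        OnQ z = ∃[ l ] l ≤ j × z ≡ at Q l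
        OnP z = ∃[ l ] i₁ < l × l ≤ i₂ × z ≡ at P l

        end₁ : f₁ (j ∸ i₁) ≡ at P i₁
        end₁ = trans (cong (at Q) (m∸[m∸n]≡n (<⇒≤ i₁<j))) (sym meet₁)

        adj₁ : ∀ k → k < j ∸ i₁ → Adj (f₁ (suc k)) (f₁ k)
        adj₁ k k< = subst (λ l → Adj (f₁ (suc k)) (at Q l))
          (∸-step (<-≤-trans k< (m∸n≤m j i₁)))
          (at-adj Q (j ∸ suc k) (≤-<-trans (m∸n≤m j (suc k)) j<d))

        f₁-injective : ∀ k l → k < l → l ≤ j ∸ i₁ → f₁ k ≢ f₁ l
        f₁-injective k l k<l l≤ eq = <⇒≢ (∸-monoʳ-< k<l (≤-trans l≤ (m∸n≤m j i₁)))
          (sym (levelQ (≤-trans (m∸n≤m j k) (<⇒≤ j<d)) (≤-trans (m∸n≤m j l) (<⇒≤ j<d)) eq))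

        fresh₁ : ∀ k → 0 < k → k ≤ j ∸ i₁ → f₁ k ∉ₗ x ∷ []
        fresh₁ k 0<k k≤ (here eq) = f₁-injective 0 k 0<k k≤ (sym eq)

        on₁ : ∀ {z} → z ∈ₗ x ∷ [] ⊎ (∃[ k ] 0 < k × k ≤ j ∸ i₁ × z ≡ f₁ k) → OnQ z
        on₁ (inj₁ (here eq))         = j , ≤-refl , eq
        on₁ (inj₂ (k , _ , _ , eq)) = j ∸ k , m∸n≤m j k , eq

        path₁ : Σ[ w ∈ Walk G (at P i₁) x ] IsPath G w × (∀ {z} → z ∈ₗ vertices G w → OnQ z)
        path₁ with w , p , only , _ ← prolong (j ∸ i₁) f₁ refl end₁ ε ([] ∷ []) adj₁ f₁-injective fresh₁ =
          w , p , λ z∈ → on₁ (only z∈)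

        level₂ : ∀ {k} → k ≤ i₂ ∸ i₁ → k + i₁ ≤ i₂
        level₂ {k} k≤ = ≤-trans (+-monoˡ-≤ i₁ k≤) (≤-reflexive (m∸n+n≡m (<⇒≤ (<-trans i₁<j j<i₂))))

        f₂-injective : ∀ k l → k < l → l ≤ i₂ ∸ i₁ → f₂ k ≢ f₂ l
        f₂-injective k l k<l l≤ eq = <⇒≢ k<l (+-cancelʳ-≡ i₁ k l
          (same-level P P (≤-trans (level₂ (≤-trans (<⇒≤ k<l) l≤)) i₂≤d) (≤-trans (level₂ l≤) i₂≤d) eq))

        -- A common vertex would have the same index on P and Q. This index exceeds i₁ and is at
        -- most j, so it lies where the geodesics are apart.
        fresh₂ : (w : Walk G (at P i₁) x) → (∀ {z} → z ∈ₗ vertices G w → OnQ z) →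
                ∀ k → 0 < k → k ≤ i₂ ∸ i₁ → f₂ k ∉ₗ vertices G w
        fresh₂ w on k 0<k k≤ z∈ with l , l≤j , eq ← on z∈
          with refl ← same-level P Q (≤-trans (level₂ k≤) i₂≤d) (≤-trans l≤j (<⇒≤ j<d)) eq =
          apart (k + i₁) (+-monoˡ-< i₁ 0<k) (≤-<-trans l≤j j<i₂) eq

        path₂ : Σ[ w ∈ Walk G (at Q i₂) x ] IsPath G w ×
                  (∀ {z} → z ∈ₗ vertices G w → OnQ z ⊎ OnP z) × y ∈ₗ vertices G w
        path₂ with w , p , on ← path₁
          with w′ , p′ , only , _ , has ← prolong (i₂ ∸ i₁) f₂ refl
            (trans (cong (at P) (m∸n+n≡m (<⇒≤ (<-trans i₁<j j<i₂)))) meet₂) w p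
            (λ k k< → adj-sym (at-adj P (k + i₁) (<-≤-trans (level₂ k<) i₂≤d)))
            f₂-injective (fresh₂ w on) =
          w′ , p′ , Sum.map on (λ (k , 0<k , k≤ , eq) →
            k + i₁ , +-monoˡ-< i₁ 0<k , level₂ k≤ , eq) ∘ only ,
          subst (λ l → at P l ∈ₗ vertices G w′) (m∸n+n≡m (<⇒≤ i₁<i))
            (has (i ∸ i₁) (∸-monoˡ-≤ i₁ (<⇒≤ i<i₂)))

        bound₃ : ∀ {k} → k ≤ i₂ ∸ suc j → suc j ≤ i₂ ∸ k
        bound₃ {k} k≤ = subst (_≤ i₂ ∸ k) (m∸[m∸n]≡n j<i₂) (∸-monoʳ-≤ i₂ k≤)

        ≤d₃ : ∀ k → i₂ ∸ k ≤ d
        ≤d₃ k = ≤-trans (m∸n≤m i₂ k) i₂≤d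

        adj₃ : ∀ k → k < i₂ ∸ suc j → Adj (f₃ (suc k)) (f₃ k)
        adj₃ k k< = subst (λ l → Adj (f₃ (suc k)) (at Q l)) (∸-step (<-≤-trans k< (m∸n≤m i₂ (suc j))))
          (at-adj Q (i₂ ∸ suc k) (<-≤-trans
            (∸-monoʳ-< {i₂} z<s (<-≤-trans k< (m∸n≤m i₂ (suc j)))) i₂≤d))

        f₃-injective : ∀ k l → k < l → l ≤ i₂ ∸ suc j → f₃ k ≢ f₃ l
        f₃-injective k l k<l l≤ eq = <⇒≢ (∸-monoʳ-< k<l (≤-trans l≤ (m∸n≤m i₂ (suc j))))
          (sym (levelQ (≤d₃ k) (≤d₃ l) eq))

        fresh₃ : (w : Walk G (at Q i₂) x) → (∀ {z} → z ∈ₗ vertices G w → OnQ z ⊎ OnP z) →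
                ∀ k → 0 < k → k ≤ i₂ ∸ suc j → f₃ k ∉ₗ vertices G w
        fresh₃ w on k 0<k k≤ z∈ with on z∈
        ... | inj₁ (l , l≤j , eq) =
          <⇒≢ (≤-<-trans l≤j (bound₃ k≤)) (sym (levelQ (≤d₃ k) (≤-trans l≤j (<⇒≤ j<d)) eq))
        ... | inj₂ (l , i₁<l , l≤i₂ , eq)
          with refl ← same-level Q P (≤d₃ k) (≤-trans l≤i₂ i₂≤d) eq =
          apart _ i₁<l (∸-monoʳ-< {i₂} 0<k (≤-trans k≤ (m∸n≤m i₂ (suc j)))) (sym eq)

        path₃ : Σ[ w ∈ Walk G x⁺ x ] IsPath G w × y ∈ₗ vertices G w
        path₃ = prepend path₂
          where
          prepend : Σ[ w ∈ Walk G (at Q i₂) x ] IsPath G w ×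
                      (∀ {z} → z ∈ₗ vertices G w → OnQ z ⊎ OnP z) × y ∈ₗ vertices G w →
                    Σ[ w ∈ Walk G x⁺ x ] IsPath G w × y ∈ₗ vertices G w
          prepend (w , p , on , y∈)
            with w′ , p′ , _ , keeps , _ ← prolong (i₂ ∸ suc j) f₃ refl (cong (at Q) (m∸[m∸n]≡n j<i₂))
                   w p adj₃ f₃-injective (fresh₃ w on) =
            w′ , p′ , keeps y∈

        R : Fin n → Fin n → Set
        R s t = Adj s t × ((s ≢ y × t ≢ y) × ¬ (s ≡ x × t ≡ x⁺) × ¬ (s ≡ x⁺ × t ≡ x))

        before : Star R u x
        before = subst (λ s → Star R s x) (at-start Q) (along j (at Q) r)
          where
          r : ∀ k → k < j → R (at Q k) (at Q (suc k))
          r k k<j = at-adj Q k k<d , (y∉Q (<⇒≤ k<d) , y∉Q k<d) ,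
            (λ (eq , _) → <⇒≢ k<j (levelQ (<⇒≤ k<d) (<⇒≤ j<d) eq)) ,
            (λ (eq , _) → <⇒≢ (m<n⇒m<1+n k<j) (levelQ (<⇒≤ k<d) j<d eq))
            where k<d = <-trans k<j j<d

        after : Star R x⁺ v
        after = subst (Star R x⁺) (trans (cong (at Q) (m∸n+n≡m j<d)) (at-end Q))
                  (along (d ∸ suc j) (λ k → at Q (k + suc j)) r)
          where
          r : ∀ k → k < d ∸ suc j → R (at Q (k + suc j)) (at Q (suc k + suc j))
          r k k< = at-adj Q l l<d , (y∉Q (<⇒≤ l<d) , y∉Q l<d) ,
            (λ (eq , _) → <⇒≢ j<l (sym (levelQ (<⇒≤ l<d) (<⇒≤ j<d) eq))) ,
            (λ (_ , eq) → <⇒≢ (m<n⇒m<1+n j<l) (sym (levelQ l<d (<⇒≤ j<d) eq)))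
            where
            l = k + suc j
            j<l : j < l
            j<l = m≤n+m (suc j) k
            l<d : l < d
            l<d = subst (l <_) (m∸n+n≡m j<d) (+-monoˡ-< (suc j) k<)

      -- Going along Q from x⁺ to v, back along the supposed walk to u and along Q again to x avoids
      -- both y and the edge {x , x⁺}. On the other hand, `path₃` joins x⁺ to x through y, so this
      -- edge would lie on two different cycles.
      separation : Star (λ s t → Adj s t × (s ≢ x × s ≢ y) × (t ≢ x × t ≢ y)) u v → ⊥
      separation w = contradict path₃
        where
        back : ∀ {s t} → Adj s t × (s ≢ x × s ≢ y) × (t ≢ x × t ≢ y) → R t s
        back (s~t , (s≢x , s≢y) , (t≢x , t≢y)) =
          adj-sym s~t , (t≢y , s≢y) , (t≢x ∘ proj₁) , (s≢x ∘ proj₂)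
        around : Star R x⁺ x
        around = after ◅◅ Star.reverse back w ◅◅ before
        contradict : Σ[ w ∈ Walk G x⁺ x ] IsPath G w × y ∈ₗ vertices G w → ⊥
        contradict (w , p , y∈) = cycle-vertex-unavoidable (at-adj Q j j<d)
          (y∉Q (<⇒≤ j<d) ∘ sym) (y∉Q j<d ∘ sym) w p y∈ around

-- Strong geodetic sets of cacti

lookup-injective : ∀ {A : Set} {xs : List A} → Unique xs →
                   ∀ {i j} → List.lookup xs i ≡ List.lookup xs j → i ≡ j
lookup-injective (x∉ ∷ xs!) {Fin.zero}  {Fin.zero}  eq = refl
lookup-injective (x∉ ∷ xs!) {Fin.zero}  {Fin.suc j} eq = contradiction eq (All.lookup x∉ (∈-lookup j))
lookup-injective (x∉ ∷ xs!) {Fin.suc i} {Fin.zero}  eq =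
  contradiction (sym eq) (All.lookup x∉ (∈-lookup i))
lookup-injective (x∉ ∷ xs!) {Fin.suc i} {Fin.suc j} eq = cong Fin.suc (lookup-injective xs! eq)

unique⇒length≤ : ∀ {n} {xs : List (Fin n)} → Unique xs → length xs ≤ n
unique⇒length≤ xs! = Fin.injective⇒≤ (lookup-injective xs!)

full⇒length≥ : ∀ {n} {xs : List (Fin n)} → (∀ x → x ∈ₗ xs) → n ≤ length xs
full⇒length≥ {xs = xs} full = Fin.injective⇒≤ {f = index ∘ full} λ {x} {y} eq →
  trans (lookup-index (full x)) (trans (cong (List.lookup xs) eq) (sym (lookup-index (full y))))

least : ∀ {P : ℕ → Set} → (∀ k → Dec (P k)) → ∀ m → P m → ∃[ k ] P k × ∀ j → j < k → ¬ P j
least P? zero    p = 0 , p , λ _ ()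
least {P} P? (suc m) p with P? 0
... | yes p₀ = 0 , p₀ , λ _ ()
... | no ¬p₀ with k , pₖ , min ← least (P? ∘ suc) m p =
  suc k , pₖ , λ { zero _ → ¬p₀ ; (suc j) (s≤s j<k) → min j j<k }

module Agreement {A : Set} (_≟_ : (x y : A) → Dec (x ≡ y)) (f g : ℕ → A) where

  last-below : ∀ j → f 0 ≡ g 0 → f j ≢ g j →
               ∃[ i ] i < j × f i ≡ g i × (∀ k → i < k → k ≤ j → f k ≢ g k)
  last-below zero    f₀ f≢g = contradiction f₀ f≢g
  last-below (suc j) f₀ f≢g with f j ≟ g j
  ... | yes eq = j , ≤-refl , eq ,
                 λ k j<k k≤1+j → subst (λ k → f k ≢ g k) (≤-antisym j<k k≤1+j) f≢g
  ... | no neq with i , i<j , eq , apart ← last-below j f₀ neq =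
    i , m<n⇒m<1+n i<j , eq , λ k i<k k≤1+j → case k i<k (m≤n⇒m<n∨m≡n k≤1+j)
    where
    case : ∀ k → i < k → k < suc j ⊎ k ≡ suc j → f k ≢ g k
    case k i<k (inj₁ (s≤s k≤j)) = apart k i<k k≤j
    case k i<k (inj₂ refl)      = f≢g

  first-above : ∀ m j → f j ≢ g j → f (m + j) ≡ g (m + j) →
                ∃[ i ] j < i × i ≤ m + j × f i ≡ g i × (∀ k → j ≤ k → k < i → f k ≢ g k)
  first-above zero    j f≢g eq = contradiction eq f≢g
  first-above (suc m) j f≢g eq with f (suc j) ≟ g (suc j)
  ... | yes eq′ = suc j , ≤-refl , s≤s (m≤n+m j m) , eq′ ,
                  λ { k j≤k (s≤s k≤j) → subst (λ k → f k ≢ g k) (≤-antisym j≤k k≤j) f≢g }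
  ... | no neq with i , 1+j<i , i≤ , eq′ , apart ←
                      first-above m (suc j) neq (subst (λ k → f k ≡ g k) (sym (+-suc m j)) eq) =
    i , <-trans (n<1+n j) 1+j<i , ≤-trans i≤ (≤-reflexive (+-suc m j)) , eq′ ,
    λ k j≤k k<i → case k k<i (m≤n⇒m<n∨m≡n j≤k)
    where
    case : ∀ k → k < i → j < k ⊎ j ≡ k → f k ≢ g k
    case k k<i (inj₁ j<k)  = apart k j<k k<i
    case k k<i (inj₂ refl) = f≢g

module Characterization {n : ℕ} (G : Graph n) (X : Subset n) where

  open Graph G
  open Walks G
  open Geodesic

  Near : ℕ → Fin n → Fin n → Set
  Near k u v = Σ[ w ∈ Walk G u v ] walkLength G w ≤ k

  near-zero : ∀ {u v} → Near 0 u v ⇔ u ≡ v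
  near-zero = mk⇔ (λ (w , l) → walkLength≡0 w l) (λ { refl → ε , z≤n })

  -- The alternative u ≡ x accounts for the walks that are shorter than the bound. The machine fills
  -- its distance table by this recurrence.
  near-suc : ∀ {k u v} → Near (suc k) u v ⇔ (∃[ x ] (u ≡ x ⊎ Adj u x) × Near k x v)
  near-suc {k} {u} {v} = mk⇔ forwards backwards
    where
    forwards : Near (suc k) u v → ∃[ x ] (u ≡ x ⊎ Adj u x) × Near k x v
    forwards (ε , _)         = u , inj₁ refl , ε , z≤n
    forwards (e ◅ w , s≤s l) = _ , inj₂ e , w , l
    backwards : (∃[ x ] (u ≡ x ⊎ Adj u x) × Near k x v) → Near (suc k) u v
    backwards (_ , inj₁ refl , w , l) = w , m≤n⇒m≤1+n l
    backwards (_ , inj₂ e , w , l)    = e ◅ w , s≤s l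

  near? : ∀ k u v → Dec (Near k u v)
  near? zero    u v = map′ (from near-zero) (to near-zero) (u Fin.≟ v)
  near? (suc k) u v = map′ (from near-suc) (to near-suc)
    (Fin.any? λ x → (u Fin.≟ x ⊎-dec T? (adj u x)) ×-dec near? k x v)

  near-sym : ∀ {k u v} → Near k u v → Near k v u
  near-sym (w , len) = proj₁ (rev w) , ≤-trans (≤-reflexive (proj₂ (rev w))) len
    where
    rev : ∀ {u v} (w : Walk G u v) → Σ[ w′ ∈ Walk G v u ] walkLength G w′ ≡ walkLength G w
    rev ε       = ε , refl
    rev (e ◅ w) with w′ , eq ← rev w = w′ ◅◅ adj-sym e ◅ ε ,
      trans (walkLength-◅◅ w′ _) (trans (+-comm _ 1) (cong suc eq))

  -- The vertices of a path are distinct. This is why the criterion has to consider only lengths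
  -- below n.
  path-length< : ∀ {u v} (w : Walk G u v) → IsPath G w → walkLength G w < n
  path-length< w p = ≤-trans (≤-reflexive (sym (length-vertices w))) (unique⇒length≤ p)

  -- A missed vertex x, put in front of the at least n distinct vertices of w, would give more than
  -- n distinct ones.
  spanning : ∀ {u v} (w : Walk G u v) → IsPath G w → n ≤ suc (walkLength G w) → ∀ x → x ∈ₗ vertices G w
  spanning w p n≤ x with x ∈ₗ? vertices G w
  ... | yes x∈ = x∈
  ... | no x∉ = contradiction (unique⇒length≤ (unique-∷ x∉ p))
                  (<⇒≱ (s≤s (≤-trans n≤ (≤-reflexive (sym (length-vertices w))))))

  -- With minimality among all walks the path property comes for free, so a rerouted walk needs only
  -- a check of its length.
  record Shortest (u v : Fin n) : Set where
    field
      path : Walk G u v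
      min  : ∀ (w : Walk G u v) → walkLength G path ≤ walkLength G w

    path-isPath : IsPath G path
    path-isPath = shortest⇒path path min

  open Shortest

  shortestPath : ∀ {u v} → Shortest u v → ShortestPath G u v
  shortestPath s = record { walk = path s ; isPath = path-isPath s ; shortest = λ w _ → min s w }

  shortest : ∀ {u v} → Walk G u v → Shortest u v
  shortest {u} {v} w
    with k , (p , p≤k) , below ← least (λ k → near? k u v) (walkLength G w) (w , ≤-refl) =
    record { path = p ; min = λ w′ → ≮⇒≥ λ lt → below _ (<-≤-trans lt p≤k) (w′ , ≤-refl) }

  -- Unlike an `Assignment`, a routing does not depend on membership proofs and is defined at all
  -- pairs, so that it can be changed at a single pair by comparing vertices.
  Routing : Set
  Routing = ∀ u v → Shortest u v

  Covers : Routing → Fin n → Set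
  Covers J x = ∃[ u ] ∃[ v ] u ∈ X × v ∈ X × u Fin.< v × x ∈ₗ vertices G (path (J u v))

  covers? : ∀ J x → Dec (Covers J x)
  covers? J x = Fin.any? λ u → Fin.any? λ v →
    (u ∈? X) ×-dec (v ∈? X) ×-dec (u Fin.<? v) ×-dec (x ∈ₗ? vertices G (path (J u v)))

  assignment : Routing → Assignment G X
  assignment J u v _ _ _ = shortestPath (J u v)

  covering⇒strong : ∀ J → (∀ x → x ∉ X → Covers J x) → IsStrongGeodetic G X
  covering⇒strong J cov = assignment J , λ x x∉X →
    let u , v , u∈X , v∈X , u<v , x∈ = cov x x∉X in u , v , u∈X , v∈X , u<v , x∈

  -- Only paths of increasing pairs count for `Covers`; if t < s, the path from t to s is therefore
  -- taken and reversed.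
  avoiding-pair : ∀ {P : Fin n → Set} (J : Routing) {s t} → s ≢ t →
    (s Fin.< t → ∀ {z} → z ∈ₗ vertices G (path (J s t)) → P z) →
    (t Fin.< s → ∀ {z} → z ∈ₗ vertices G (path (J t s)) → P z) →
    Star (λ a b → Adj a b × P a × P b) s t
  avoiding-pair J {s} {t} s≢t p q with Fin.<-cmp s t
  ... | tri< s<t _ _ = avoiding (path (J s t)) (p s<t)
  ... | tri≈ _ s≡t _ = contradiction s≡t s≢t
  ... | tri> _ _ t<s = Star.reverse (λ (a~b , pa , pb) → adj-sym a~b , pb , pa)
                         (avoiding (path (J t s)) (q t<s))

  assemble : ∀ m (f : ℕ → Fin n) {u v} → f 0 ≡ u → f m ≡ v → (∀ i → i < m → Adj (f i) (f (suc i))) →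
             Σ[ w ∈ Walk G u v ] walkLength G w ≡ m × (∀ i → i ≤ m → f i ∈ₗ vertices G w)
  assemble m f refl refl r = along m f r , along-length m f r , along-∈ m f r

  module Exchange (cactus : IsCactus G) (J : Routing) {u v w x : Fin n}
    (u∈X : u ∈ X) (v∈X : v ∈ X) (w∈X : w ∈ X) (u<v : u Fin.< v) (w≢u : w ≢ u) (w≢v : w ≢ v)
    (uncovered : ¬ Covers J x) (a : Walk G u x) (b : Walk G x v)
    (a+b≤ : walkLength G a + walkLength G b ≤ walkLength G (path (J u v))) where

    d j : ℕ
    d = walkLength G (path (J u v))
    j = walkLength G a

    ab-length : walkLength G (a ◅◅ b) ≡ d
    ab-length = ≤-antisym (≤-trans (≤-reflexive (walkLength-◅◅ a b)) a+b≤) (min (J u v) (a ◅◅ b))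

    P Q : Geodesic u v d
    P = geodesic (path (J u v)) refl (min (J u v))
    Q = geodesic (a ◅◅ b) ab-length (min (J u v))

    Qj≡x : at Q j ≡ x
    Qj≡x = position-◅◅ a b

    j≤d : j ≤ d
    j≤d = ≤-trans (m≤m+n j _) a+b≤

    Pj≢Qj : at P j ≢ at Q j
    Pj≢Qj eq = uncovered (u , v , u∈X , v∈X , u<v ,
      subst (_∈ₗ vertices G (path (J u v))) (trans eq Qj≡x) (position-∈ (path (J u v)) j))

    open Agreement Fin._≟_ (at P) (at Q)

    meet-below : ∃[ i₁ ] i₁ < j × at P i₁ ≡ at Q i₁ × (∀ k → i₁ < k → k ≤ j → at P k ≢ at Q k)
    meet-below = last-below j (trans (at-start P) (sym (at-start Q))) Pj≢Qj

    meet-above : ∃[ i₂ ] j < i₂ × i₂ ≤ d × at P i₂ ≡ at Q i₂ × (∀ k → j ≤ k → k < i₂ → at P k ≢ at Q k)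
    meet-above with i₂ , j<i₂ , i₂≤ , eq , apart ← first-above (d ∸ j) j Pj≢Qj
                      (subst (λ k → at P k ≡ at Q k) (sym (m∸n+n≡m j≤d))
                        (trans (at-end P) (sym (at-end Q)))) =
      i₂ , j<i₂ , ≤-trans i₂≤ (≤-reflexive (m∸n+n≡m j≤d)) , eq , apart

    module Detour {i₁ i₂ : ℕ} (i₁<j : i₁ < j) (j<i₂ : j < i₂) (i₂≤d : i₂ ≤ d)
      (meet₁ : at P i₁ ≡ at Q i₁) (meet₂ : at P i₂ ≡ at Q i₂)
      (apart : ∀ k → i₁ < k → k < i₂ → at P k ≢ at Q k) where

      detour : ℕ → Fin n
      detour k with i₁ <? k | k <? i₂
      ... | yes _ | yes _ = at Q k
      ... | no _  | _     = at P k
      ... | _     | no _  = at P k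

      -- At i₁ and i₂ the value comes from P, which meets Q there. Because both descriptions hold at
      -- these two indices, every edge of the detour is an edge of P or an edge of Q.
      on-Q : ∀ k → i₁ ≤ k → k ≤ i₂ → detour k ≡ at Q k
      on-Q k i₁≤k k≤i₂ with i₁ <? k | k <? i₂
      ... | yes _   | yes _   = refl
      ... | no i₁≮k | _       with refl ← ≤-antisym i₁≤k (≮⇒≥ i₁≮k) = meet₁
      ... | yes _   | no k≮i₂ with refl ← ≤-antisym k≤i₂ (≮⇒≥ k≮i₂) = meet₂

      on-P : ∀ k → k ≤ i₁ ⊎ i₂ ≤ k → detour k ≡ at P k
      on-P k out with i₁ <? k | k <? i₂
      ... | yes i₁<k | yes k<i₂ = Sum.[ (λ k≤i₁ → contradiction i₁<k (≤⇒≯ k≤i₁))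
                                      , (λ i₂≤k → contradiction k<i₂ (≤⇒≯ i₂≤k)) ] out
      ... | no _     | _        = refl
      ... | yes _    | no _     = refl

      detour-adj : ∀ k → k < d → Adj (detour k) (detour (suc k))
      detour-adj k k<d = case (i₁ ≤? k) (k <? i₂)
        where
        outside : k < i₁ ⊎ i₂ ≤ k → Adj (detour k) (detour (suc k))
        outside out = subst₂ Adj (sym (on-P k (Sum.map₁ <⇒≤ out)))
          (sym (on-P (suc k) (Sum.map₂ m≤n⇒m≤1+n out))) (at-adj P k k<d)
        case : Dec (i₁ ≤ k) → Dec (k < i₂) → Adj (detour k) (detour (suc k))
        case (yes i₁≤k) (yes k<i₂) = subst₂ Adj (sym (on-Q k i₁≤k (<⇒≤ k<i₂)))
          (sym (on-Q (suc k) (m≤n⇒m≤1+n i₁≤k) k<i₂)) (at-adj Q k k<d)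
        case (no i₁≰k)  _          = outside (inj₁ (≰⇒> i₁≰k))
        case (yes _)    (no k≮i₂)  = outside (inj₂ (≮⇒≥ k≮i₂))

      assembled : Σ[ w ∈ Walk G u v ] walkLength G w ≡ d × (∀ i → i ≤ d → detour i ∈ₗ vertices G w)
      assembled = assemble d detour (trans (on-P 0 (inj₁ z≤n)) (at-start P))
                    (trans (on-P d (inj₂ i₂≤d)) (at-end P)) detour-adj

      rerouted : Shortest u v
      rerouted = record { path = proj₁ assembled
        ; min = λ w → subst (_≤ walkLength G w) (sym (proj₁ (proj₂ assembled))) (min (J u v) w) }

      J′ : Routing
      J′ s t with s Fin.≟ u | t Fin.≟ v
      ... | yes refl | yes refl = rerouted
      ... | _        | _        = J s t

      J′-here : J′ u v ≡ rerouted
      J′-here with u Fin.≟ u | v Fin.≟ v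
      ... | yes refl | yes refl = refl
      ... | no u≢u   | _        = contradiction refl u≢u
      ... | yes _    | no v≢v   = contradiction refl v≢v

      J′-there : ∀ {s t} → s ≢ u ⊎ t ≢ v → J′ s t ≡ J s t
      J′-there {s} {t} neq with s Fin.≟ u | t Fin.≟ v
      ... | yes refl | yes refl = Sum.[ contradiction refl , contradiction refl ] neq
      ... | no _     | _        = refl
      ... | yes refl | no _     = refl

      on-detour : ∀ {k} → k ≤ d → Covers J′ (detour k)
      on-detour {k} k≤d = u , v , u∈X , v∈X , u<v ,
        subst (λ s → detour k ∈ₗ vertices G (path s)) (sym J′-here) (proj₂ (proj₂ assembled) k k≤d)

      kept : ∀ {s t y} → s ≢ u ⊎ t ≢ v → s ∈ X → t ∈ X → s Fin.< t →
             y ∈ₗ vertices G (path (J s t)) → Covers J′ y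
      kept {s} {t} {y} neq s∈X t∈X s<t y∈ = s , t , s∈X , t∈X , s<t ,
        subst (λ p → y ∈ₗ vertices G (path p)) (sym (J′-there neq)) y∈

      x-covered : Covers J′ x
      x-covered = subst (Covers J′) (trans (on-Q j (<⇒≤ i₁<j) (<⇒≤ j<i₂)) Qj≡x) (on-detour j≤d)

      -- If the paths from w to u and to v both missed x and at P i, they
      -- would link the two sides of the cycle formed by P and Q.
      bypassed : ∀ i → i₁ < i → i < i₂ → Covers J′ (at P i)
      bypassed i i₁<i i<i₂ with covers? J′ (at P i)
      ... | yes c = c
      ... | no ¬c = ⊥-elim (separation P Q i₁<i i<i₂ i₁<j j<i₂ i₂≤d meet₁ meet₂ apart
        (avoiding-pair J (w≢u ∘ sym) (misses (inj₂ w≢v) u∈X w∈X) (misses (inj₁ w≢u) w∈X u∈X) ◅◅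
         avoiding-pair J w≢v (misses (inj₁ w≢u) w∈X v∈X) (misses (inj₂ w≢v) v∈X w∈X)))
        where
        open Cactus cactus
        -- The paths of all pairs other than (u , v) belong to both routings. They avoid x, which
        -- `J` leaves uncovered, and at P i, which `J′` is assumed to leave uncovered.
        misses : ∀ {s t} → s ≢ u ⊎ t ≢ v → s ∈ X → t ∈ X → s Fin.< t →
                 ∀ {z} → z ∈ₗ vertices G (path (J s t)) → z ≢ at Q j × z ≢ at P i
        misses neq s∈X t∈X s<t z∈ =
          (λ { refl → uncovered (subst (Covers J) Qj≡x (_ , _ , s∈X , t∈X , s<t , z∈)) }) ,
          (λ { refl → ¬c (kept neq s∈X t∈X s<t z∈) })

      covered-kept : ∀ {y} → Covers J y → Covers J′ y
      covered-kept {y} (s , t , s∈X , t∈X , s<t , y∈) with s Fin.≟ u | t Fin.≟ v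
      ... | no s≢u | _      = kept (inj₁ s≢u) s∈X t∈X s<t y∈
      ... | yes _  | no t≢v = kept (inj₂ t≢v) s∈X t∈X s<t y∈
      ... | yes refl | yes refl with i , i≤d , refl ← ∈-position (path (J u v)) y∈
        with i₁ <? i | i <? i₂
      ...   | yes i₁<i | yes i<i₂ = bypassed i i₁<i i<i₂
      ...   | no i₁≮i | _ = subst (Covers J′) (on-P i (inj₁ (≮⇒≥ i₁≮i))) (on-detour i≤d)
      ...   | yes _ | no i≮i₂ = subst (Covers J′) (on-P i (inj₂ (≮⇒≥ i≮i₂))) (on-detour i≤d)

    exchange : Σ[ J′ ∈ Routing ] Covers J′ x × (∀ {y} → Covers J y → Covers J′ y)
    exchange with i₁ , i₁<j , meet₁ , apart₁ ← meet-below
      | i₂ , j<i₂ , i₂≤d , meet₂ , apart₂ ← meet-above =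
      J′ , x-covered , covered-kept
      where
      open Detour i₁<j j<i₂ i₂≤d meet₁ meet₂
        (λ k i₁<k k<i₂ → Sum.[ apart₁ k i₁<k , (λ j≤k → apart₂ k j≤k k<i₂) ]′ (≤-total k j))

  -- The distance is not named: every bound k on it has to split at x into bounds for the two parts.
  -- Taking k to be the distance, which is below n, gives a geodesic through x.
  OnGeodesic : Fin n → Fin n → Fin n → Set
  OnGeodesic u x v = ∀ k → k < n → Near k u v → ∃[ i ] i < suc k × Near i u x × Near (k ∸ i) x v

  Third : Set
  Third = ∃[ a ] a ∈ X × ∃[ b ] b ∈ X × ∃[ c ] c ∈ X × a ≢ b × a ≢ c × b ≢ c

  -- Distance at least n - 1, again expressed through all bounds k on the distance.
  Spanned : Fin n → Fin n → Set
  Spanned u v = ∀ k → k < n → Near k u v → n ≤ suc k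

  Between : Fin n → Set
  Between x = ∃[ u ] u ∈ X × ∃[ v ] v ∈ X × OnGeodesic u x v

  Criterion : Set
  Criterion = (∀ x → x ∈ X) ⊎
              (Third × ∀ x → x ∈ X ⊎ Between x) ⊎
              (∃[ u ] u ∈ X × ∃[ v ] v ∈ X × Spanned u v)

  onGeodesic-sym : ∀ {u x v} → OnGeodesic u x v → OnGeodesic v x u
  onGeodesic-sym {u} {x} {v} og k k<n v~u with i , s≤s i≤k , u~x , x~v ← og k k<n (near-sym v~u) =
    k ∸ i , s≤s (m∸n≤m k i) , near-sym x~v ,
    subst (λ l → Near l x u) (sym (m∸[m∸n]≡n i≤k)) (near-sym u~x)

  spanned-sym : ∀ {u v} → Spanned u v → Spanned v u
  spanned-sym sp k k<n v~u = sp k k<n (near-sym v~u)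

  detour-walks : ∀ {u x v} (s : Shortest u v) → OnGeodesic u x v →
    Σ[ a ∈ Walk G u x ] Σ[ b ∈ Walk G x v ] walkLength G a + walkLength G b ≤ walkLength G (path s)
  detour-walks s og
    with i , s≤s i≤k , (a , a≤) , (b , b≤) ← og _ (path-length< (path s) (path-isPath s))
      (path s , ≤-refl) =
    a , b , ≤-trans (+-mono-≤ a≤ b≤) (≤-reflexive (m+[n∸m]≡n i≤k))

  -- The criterion allows u and v in either order and even u ≡ v, which keeps the formula short. In
  -- both applications a vertex x outside X excludes equality: a shortest walk from u to u has
  -- length 0, and x would have to coincide with u.
  ordered : ∀ {R : Fin n → Fin n → Set} → (∀ {u v} → R u v → R v u) → (∀ {u} → u ∈ X → ¬ R u u) →
            ∀ {u v} → u ∈ X → v ∈ X → R u v → ∃[ u ] ∃[ v ] u ∈ X × v ∈ X × u Fin.< v × R u v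
  ordered R-sym R-irr {u} {v} u∈X v∈X r with Fin.<-cmp u v
  ... | tri< u<v _ _  = u , v , u∈X , v∈X , u<v , r
  ... | tri≈ _ refl _ = contradiction r (R-irr u∈X)
  ... | tri> _ _ v<u  = v , u , v∈X , u∈X , v<u , R-sym r

  stationary : ∀ {u} (s : Shortest u u) → walkLength G (path s) ≤ 0
  stationary s = min s ε

  other : ∀ u v → Third → ∃[ w ] w ∈ X × w ≢ u × w ≢ v
  other u v (a , a∈ , b , b∈ , c , c∈ , a≢b , a≢c , b≢c) with a Fin.≟ u | a Fin.≟ v | b Fin.≟ u
    | b Fin.≟ v
  ... | no a≢u   | no a≢v   | _        | _        = a , a∈ , a≢u , a≢v
  ... | _        | _        | no b≢u   | no b≢v   = b , b∈ , b≢u , b≢v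
  ... | yes refl | _        | yes refl | _        = contradiction refl a≢b
  ... | _        | yes refl | _        | yes refl = contradiction refl a≢b
  ... | yes refl | _        | no _     | yes refl = c , c∈ , a≢c ∘ sym , b≢c ∘ sym
  ... | no _     | yes refl | yes refl | _        = c , c∈ , b≢c ∘ sym , a≢c ∘ sym

  module _ (cactus : IsCactus G) where

    routing : Routing
    routing u v = shortest (proj₂ (proj₁ cactus) u v)

    -- The routing found for the tail of the list is exchanged at most once, to cover the head;
    -- since an exchange preserves coverage, the tail remains covered.
    cover-list : Third → (∀ x → x ∈ X ⊎ Between x) → ∀ xs →
                 Σ[ J ∈ Routing ] ∀ {x} → x ∈ₗ xs → x ∉ X → Covers J x
    cover-list third between []       = routing , λ ()
    cover-list third between (x ∷ xs) with cover-list third between xs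
    ... | J , cov with x ∈? X | covers? J x | between x
    ...   | yes x∈X | _ | _ = J , λ { (here refl) x∉X → contradiction x∈X x∉X ; (there y∈) → cov y∈ }
    ...   | _ | yes c | _ = J , λ { (here refl) _ → c ; (there y∈) → cov y∈ }
    ...   | no x∉X | _ | inj₁ x∈X = contradiction x∈X x∉X
    ...   | no x∉X | no ¬c | inj₂ (u₀ , u₀∈X , v₀ , v₀∈X , og₀)
      with u , v , u∈X , v∈X , u<v , og ← ordered {λ u v → OnGeodesic u x v} onGeodesic-sym
             (λ u∈X og → let a , b , l = detour-walks (routing _ _) og in
               x∉X (subst (_∈ X) (walkLength≡0 a
                 (≤-trans (m≤m+n _ _) (≤-trans l (stationary (routing _ _))))) u∈X))
             u₀∈X v₀∈X og₀
      with w , w∈X , w≢u , w≢v ← other u v third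
      with a , b , a+b≤ ← detour-walks (J u v) og
      with J′ , c , keeps ← Exchange.exchange cactus J u∈X v∈X w∈X u<v w≢u w≢v ¬c a b a+b≤ =
      J′ , λ { (here refl) _ → c ; (there y∈) y∉X → keeps (cov y∈ y∉X) }

    criterion⇒strong : Criterion → IsStrongGeodetic G X
    criterion⇒strong (inj₁ all) = covering⇒strong routing λ x x∉X → contradiction (all x) x∉X
    criterion⇒strong (inj₂ (inj₁ (third , between))) with J , cov ← cover-list third between (allFin n) =
      covering⇒strong J λ x → cov (∈-allFin x)
    criterion⇒strong (inj₂ (inj₂ (u₀ , u₀∈X , v₀ , v₀∈X , sp₀))) = covering⇒strong routing λ x x∉X →
      let u , v , u∈X , v∈X , u<v , sp = ordered {Spanned} spanned-sym
            (λ u∈X sp → x∉X (subst (_∈ X) (sole (path (routing _ _)) (stationary (routing _ _))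
              (on-path sp x)) u∈X))
            u₀∈X v₀∈X sp₀
      in u , v , u∈X , v∈X , u<v , on-path sp x
      where
      on-path : ∀ {u v} → Spanned u v → ∀ x → x ∈ₗ vertices G (path (routing u v))
      on-path {u} {v} sp = spanning p p! (sp (walkLength G p) (path-length< p p!) (p , ≤-refl))
        where
        p = path (routing u v)
        p! = path-isPath (routing u v)
      sole : ∀ {u v x} (w : Walk G u v) → walkLength G w ≤ 0 → x ∈ₗ vertices G w → u ≡ x
      sole ε _ (here refl) = refl

    -- A vertex outside X is covered by the path of some u < v. If X has a third element, the chosen
    -- paths witness the second case. Otherwise u and v are all of X, and their path is the only
    -- one, so it visits all n vertices.
    strong⇒criterion : IsStrongGeodetic G X → Criterion
    strong⇒criterion (I , cov) with Fin.all? (_∈? X)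
    ... | yes all = inj₁ all
    ... | no ¬all with x₀ , x₀∉X ← Fin.¬∀⟶∃¬ n (_∈ X) (_∈? X) ¬all
      with u , v , u∈X , v∈X , u<v , _ ← cov x₀ x₀∉X
      with Fin.any? (λ w → (w ∈? X) ×-dec ¬? (w Fin.≟ u) ×-dec ¬? (w Fin.≟ v))
    ... | yes (w , w∈X , w≢u , w≢v) = inj₂ (inj₁
      ((u , u∈X , v , v∈X , w , w∈X , Fin.<⇒≢ u<v , w≢u ∘ sym , w≢v ∘ sym) , between))
      where
      between : ∀ x → x ∈ X ⊎ Between x
      between x with x ∈? X
      ... | yes x∈X = inj₁ x∈X
      ... | no x∉X with s , t , s∈X , t∈X , s<t , x∈ ← cov x x∉X
        with a , b , a+b≡ , _ ← split (ShortestPath.walk (I s t s∈X t∈X s<t)) x∈ =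
        inj₂ (s , s∈X , t , t∈X , λ k _ (w , w≤k) →
          -- The chosen path is minimal among paths only, so the given walk is first turned into a
          -- path.
          let w′ , w′! , w′≤w , _ = loopErase w
              a+b≤k = ≤-trans (≤-reflexive a+b≡)
                        (≤-trans (ShortestPath.shortest (I s t s∈X t∈X s<t) w′ w′!) (≤-trans w′≤w w≤k))
          in walkLength G a , s≤s (≤-trans (m≤m+n _ _) a+b≤k) , (a , ≤-refl) ,
             (b , m+n≤o⇒m≤o∸n _ (subst (_≤ k) (+-comm (walkLength G a) _) a+b≤k)))
    ... | no ¬third = inj₂ (inj₂ (u , u∈X , v , v∈X , spanned))
      where
      p : ShortestPath G u v
      p = I u v u∈X v∈X u<v

      u-or-v : ∀ {z} → z ∈ X → z ≡ u ⊎ z ≡ v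
      u-or-v {z} z∈X with z Fin.≟ u | z Fin.≟ v
      ... | yes z≡u | _       = inj₁ z≡u
      ... | no _    | yes z≡v = inj₂ z≡v
      ... | no z≢u  | no z≢v  = contradiction (z , z∈X , z≢u , z≢v) ¬third

      on-p : ∀ x → x ∈ₗ vertices G (ShortestPath.walk p)
      on-p x with x ∈? X
      on-p x | yes x∈X with u-or-v x∈X
      ... | inj₁ refl = start∈ (ShortestPath.walk p)
      ... | inj₂ refl = end∈ (ShortestPath.walk p)
      on-p x | no x∉X with s , t , s∈X , t∈X , s<t , x∈ ← cov x x∉X with u-or-v s∈X | u-or-v t∈X
      ... | inj₁ refl | inj₁ refl = contradiction s<t (Fin.<-irrefl refl)
      ... | inj₂ refl | inj₂ refl = contradiction s<t (Fin.<-irrefl refl)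
      ... | inj₂ refl | inj₁ refl = contradiction s<t (Fin.<-asym u<v)
      -- The assignment takes the proofs of membership and order as arguments. Their irrelevance
      -- identifies the covering path with `p`.
      ... | inj₁ refl | inj₂ refl
        rewrite []=-irrelevant s∈X u∈X | []=-irrelevant t∈X v∈X | Fin.<-irrelevant s<t u<v = x∈

      spanned : Spanned u v
      spanned k _ (w , w≤k) with w′ , w′! , w′≤w , _ ← loopErase w =
        ≤-trans (full⇒length≥ on-p) (≤-trans (≤-reflexive (length-vertices (ShortestPath.walk p)))
          (s≤s (≤-trans (ShortestPath.shortest p w′ w′!) (≤-trans w′≤w w≤k))))

-- Compilation of expressions

-- The term with the largest index comes first because the compiled loop counts down, its counter
-- being the summation variable.
∑< : ℕ → (ℕ → ℕ) → ℕ
∑< zero    f = 0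
∑< (suc n) f = f n + ∑< n f

infixl 6 _⊕_ _⊖_

data Expr (k : ℕ) : Set where
  lit     : ℕ → Expr k
  var     : Fin k → Expr k
  len     : Expr k
  _⊕_ _⊖_ : Expr k → Expr k → Expr k
  cell    : Expr k → Expr k
  sum     : Expr k → Expr (suc k) → Expr k

module Semantics (L : ℕ) (tape : ℕ → ℕ) where

  ⟦_⟧ : ∀ {k} → Expr k → Vec ℕ k → ℕ
  ⟦ lit c ⟧   ρ = c
  ⟦ var x ⟧   ρ = lookup ρ x
  ⟦ len ⟧     ρ = L
  ⟦ a ⊕ b ⟧   ρ = ⟦ a ⟧ ρ + ⟦ b ⟧ ρ
  ⟦ a ⊖ b ⟧   ρ = ⟦ a ⟧ ρ ∸ ⟦ b ⟧ ρ
  ⟦ cell a ⟧  ρ = tape (⟦ a ⟧ ρ)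
  ⟦ sum a b ⟧ ρ = ∑< (⟦ a ⟧ ρ) λ i → ⟦ b ⟧ (i ∷ ρ)

  duration : ∀ {k} → Expr k → Vec ℕ k → ℕ
  duration (lit c)   ρ = 1
  duration (var x)   ρ = 2
  duration len       ρ = 2
  duration (a ⊕ b)   ρ = duration a ρ + (duration b ρ + 1)
  duration (a ⊖ b)   ρ = duration a ρ + (duration b ρ + 1)
  duration (cell a)  ρ = duration a ρ + 3
  duration (sum a b) ρ =
    duration a ρ + (3 + (∑< (⟦ a ⟧ ρ) (λ i → 3 + (duration b (i ∷ ρ) + 1)) + 2))

-- Jump targets are absolute addresses, so the number of instructions must be known before the code
-- is generated. `height` bounds the number of consecutive registers used from the target register
-- on.
size height : ∀ {k} → Expr k → ℕ

size (lit c)   = 1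
size (var x)   = 2
size len       = 2
size (a ⊕ b)   = size a + (size b + 1)
size (a ⊖ b)   = size a + (size b + 1)
size (cell a)  = size a + 3
size (sum a b) = size a + (5 + (size b + 3))

height (lit c)   = 1
height (var x)   = 1
height len       = 1
height (a ⊕ b)   = height a + suc (height b)
height (a ⊖ b)   = height a + suc (height b)
height (cell a)  = height a + 2
height (sum a b) = height a + (3 + height b)

-- Register 0 holds the length of the input, and tape cell i is kept in
-- register base + i.
module Compiler (base : ℕ) where

  -- The value of the expression is left in register d; no register r with
  -- r < d or d + height ≤ r is changed.
  compile : ∀ {k} → Expr k → Vec ℕ k → (pc d : ℕ) → List Instruction
  compile (lit c)   regs pc d = const d c ∷ []
  -- The machine has no move instruction; a register is copied by adding it to 0.
  compile (var x)   regs pc d = const d 0 ∷ add d (lookup regs x) d ∷ []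
  compile len       regs pc d = const d 0 ∷ add d 0 d ∷ []
  compile (a ⊕ b)   regs pc d =
    compile a regs pc d ++ compile b regs (pc + size a) (suc d) ++ add d d (suc d) ∷ []
  compile (a ⊖ b)   regs pc d =
    compile a regs pc d ++ compile b regs (pc + size a) (suc d) ++ sub d d (suc d) ∷ []
  compile (cell a)  regs pc d =
    compile a regs pc d ++ const (suc d) base ∷ add d d (suc d) ∷ load d d ∷ []
  -- Register d is the counter and the summation variable, 1 + d the accumulator, and 2 + d holds
  -- first the constant 1 and then the value of b. The first jump is always taken and leads to the
  -- test at the end of the loop, so that zero rounds are possible. After the loop d is 0, and the
  -- last addition moves the total there.
  compile (sum a b) regs pc d = compile a regs pc d ++
    const (1 + d) 0 ∷
    const (2 + d) 1 ∷
    jump (2 + d) (6 + (pcₐ + size b)) ∷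
    const (2 + d) 1 ∷
    sub d d (2 + d) ∷
    compile b (d ∷ regs) (5 + pcₐ) (2 + d) ++
    add (1 + d) (1 + d) (2 + d) ∷
    jump d (3 + pcₐ) ∷
    add d (1 + d) d ∷ []
    where pcₐ = pc + size a

  length-compile : ∀ {k} (e : Expr k) regs pc d → length (compile e regs pc d) ≡ size e
  length-compile (lit c)   regs pc d = refl
  length-compile (var x)   regs pc d = refl
  length-compile len       regs pc d = refl
  length-compile (a ⊕ b)   regs pc d = trans (length-++ (compile a regs pc d))
    (cong₂ _+_ (length-compile a regs pc d) (trans (length-++ (compile b regs (pc + size a) (suc d)))
      (cong (_+ 1) (length-compile b regs (pc + size a) (suc d)))))
  length-compile (a ⊖ b)   regs pc d = trans (length-++ (compile a regs pc d))
    (cong₂ _+_ (length-compile a regs pc d) (trans (length-++ (compile b regs (pc + size a) (suc d)))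
      (cong (_+ 1) (length-compile b regs (pc + size a) (suc d)))))
  length-compile (cell a)  regs pc d = trans (length-++ (compile a regs pc d))
    (cong (_+ 3) (length-compile a regs pc d))
  length-compile (sum a b) regs pc d = trans (length-++ (compile a regs pc d))
    (cong₂ _+_ (length-compile a regs pc d) (cong (5 +_)
      (trans (length-++ (compile b (d ∷ regs) (5 + (pc + size a)) (2 + d)))
        (cong (_+ 3) (length-compile b (d ∷ regs) (5 + (pc + size a)) (2 + d))))))

-- Memory, code and execution

[≔]-same : ∀ X i x → (X [ i ≔ x ]) i ≡ x
[≔]-same X i x = cong (if_then x else X i) (T⇒true (i ≡ᵇ i) (≡⇒≡ᵇ i i refl))
  where
  T⇒true : ∀ b → T b → b ≡ true
  T⇒true true _ = refl

[≔]-other : ∀ X {i j} x → j ≢ i → (X [ i ≔ x ]) j ≡ X j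
[≔]-other X {i} {j} x j≢i with j ≡ᵇ i | ≡ᵇ⇒≡ j i
... | true  | eq = contradiction (eq tt) j≢i
... | false | _  = refl

Code : Program → ℕ → List Instruction → Set
Code p pc []       = ⊤
Code p pc (i ∷ is) = fetch p pc ≡ i × Code p (suc pc) is

code-++ : ∀ {p pc} is {js l} → length is ≡ l → Code p pc (is ++ js) → Code p pc is × Code p (pc + l) js
code-++ {p} {pc} []       {js} refl c       = tt , subst (λ q → Code p q js) (sym (+-identityʳ pc)) c
code-++ {p} {pc} (i ∷ is) {js} refl (f , c) with c₁ , c₂ ← code-++ is refl c =
  (f , c₁) , subst (λ q → Code p q js) (sym (+-suc pc _)) c₂

module Execution (p : Program) where

  -- Quantifying over the remaining time s makes the composition of runs an addition of their times.
  record Reaches (c : Configuration) (t : ℕ) (c′ : Configuration) : Set where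
    constructor reaches
    field runFor-+ : ∀ s → runFor (t + s) p c ≡ runFor s p c′

  open Reaches public

  arriving : ∀ {c t q q′ X w} → q ≡ q′ → Reaches c t ⟨ q , X , w ⟩ → Reaches c t ⟨ q′ , X , w ⟩
  arriving refl r = r

  lasting : ∀ {c t t′ c′} → t ≡ t′ → Reaches c t c′ → Reaches c t′ c′
  lasting refl r = r

  infixr 5 _⨟_
  _⨟_ : ∀ {c t c′ t′ c″} → Reaches c t c′ → Reaches c′ t′ c″ → Reaches c (t + t′) c″
  _⨟_ {c} {t} {t′ = t′} (reaches r) (reaches r′) = reaches λ s →
    trans (cong (λ t → runFor t p c) (+-assoc t t′ s)) (trans (r (t′ + s)) (r′ s))

  tick : ∀ {i pc X w c′} → fetch p pc ≡ i → execute i ⟨ pc , X , w ⟩ ≡ inj₁ c′ →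
    Reaches ⟨ pc , X , w ⟩ 1 c′
  tick {i} {pc} {X} {w} {c′} f e = reaches run
    where
    run : ∀ s → runFor (suc s) p ⟨ pc , X , w ⟩ ≡ runFor s p c′
    run s with execute (fetch p pc) ⟨ pc , X , w ⟩ | trans (cong (λ i → execute i ⟨ pc , X , w ⟩) f) e
    ... | _ | refl = refl

  jump-taken : ∀ {j m pc X w k} → fetch p pc ≡ jump j m → X j ≡ suc k →
    Reaches ⟨ pc , X , w ⟩ 1 ⟨ m , X , w ⟩
  jump-taken {m = m} {pc} {X} {w} f eq =
    tick f (cong (λ x → inj₁ ⟨ (if x ≡ᵇ 0 then suc pc else m) , X , w ⟩) eq)

  jump-not-taken : ∀ {j m pc X w} → fetch p pc ≡ jump j m → X j ≡ 0 →
    Reaches ⟨ pc , X , w ⟩ 1 ⟨ suc pc , X , w ⟩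
  jump-not-taken {m = m} {pc} {X} {w} f eq =
    tick f (cong (λ x → inj₁ ⟨ (if x ≡ᵇ 0 then suc pc else m) , X , w ⟩) eq)

  halts : ∀ {i pc X w b} → fetch p pc ≡ i → execute i ⟨ pc , X , w ⟩ ≡ inj₂ b →
          ∀ s → runFor (suc s) p ⟨ pc , X , w ⟩ ≡ just b
  halts {i} {pc} {X} {w} f e s with execute (fetch p pc) ⟨ pc , X , w ⟩
    | trans (cong (λ i → execute i ⟨ pc , X , w ⟩) f) e
  ... | _ | refl = refl

  -- The jump is taken at nonzero values, which stand for falsity, and skips the accepting
  -- instruction. Either way the second step halts.
  verdict : ∀ {r pc X w v} → fetch p pc ≡ jump r (2 + pc) → fetch p (1 + pc) ≡ accept →
            fetch p (2 + pc) ≡ reject → X r ≡ v → ∀ s → runFor (2 + s) p ⟨ pc , X , w ⟩ ≡ just (v ≡ᵇ 0)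
  verdict {v = zero}  f g h eq s = trans (runFor-+ (jump-not-taken f eq) (suc s)) (halts g refl s)
  verdict {v = suc _} f g h eq s = trans (runFor-+ (jump-taken f eq) (suc s)) (halts h refl s)

  concluding : ∀ {c t c′ b} → Reaches c t c′ → (∀ s → runFor (2 + s) p c′ ≡ just b) →
               ∀ s → runFor (t + 2 + s) p c ≡ just b
  concluding {c} {t} r e s =
    trans (cong (λ t → runFor t p c) (+-assoc t 2 s)) (trans (runFor-+ r (2 + s)) (e s))

module Correctness (base L : ℕ) (tape : ℕ → ℕ) (p : Program) where

  open Compiler base
  open Semantics L tape
  open Execution p

  record Frame (d : ℕ) (X X′ : Memory) : Set where
    constructor unchanged
    field same : ∀ r → r < d ⊎ base ≤ r → X′ r ≡ X r

  open Frame public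

  frame-refl : ∀ {d X} → Frame d X X
  frame-refl = unchanged λ r _ → refl

  frame-trans : ∀ {d X Y Z} → Frame d X Y → Frame d Y Z → Frame d X Z
  frame-trans f g = unchanged λ r out → trans (same g r out) (same f r out)

  frame-mono : ∀ {d d′ X Y} → d ≤ d′ → Frame d′ X Y → Frame d X Y
  frame-mono d≤d′ f = unchanged λ r → same f r ∘ Sum.map₁ (λ r<d → <-≤-trans r<d d≤d′)

  frame-set : ∀ {d X r x} → d ≤ r → r < base → Frame d X (X [ r ≔ x ])
  frame-set {X = X} {x = x} d≤r r<b = unchanged λ s out → [≔]-other X x
    (Sum.[ (λ s<d → <⇒≢ (<-≤-trans s<d d≤r)) , (λ b≤s → ≢-sym (<⇒≢ (<-≤-trans r<b b≤s))) ] out)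

  record Represents {k} (d : ℕ) (regs ρ : Vec ℕ k) (X : Memory) : Set where
    field
      0<d    : 0 < d
      in-len : X 0 ≡ L
      in-tape : ∀ i → X (base + i) ≡ tape i
      in-var : ∀ x → lookup regs x < d × X (lookup regs x) ≡ lookup ρ x

  open Represents

  rep-frame : ∀ {k d} {regs ρ : Vec ℕ k} {X X′} → Represents d regs ρ X → Frame d X X′ →
    Represents d regs ρ X′
  rep-frame R f = record
    { 0<d = 0<d R
    ; in-len = trans (same f 0 (inj₁ (0<d R))) (in-len R)
    ; in-tape = λ i → trans (same f (base + i) (inj₂ (m≤m+n base i))) (in-tape R i)
    ; in-var = λ x → proj₁ (in-var R x) , trans (same f _ (inj₁ (proj₁ (in-var R x))))
      (proj₂ (in-var R x)) }

  rep-mono : ∀ {k d d′} {regs ρ : Vec ℕ k} {X} → d ≤ d′ → Represents d regs ρ X → Represents d′ regs ρ X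
  rep-mono d≤d′ R = record
    { 0<d = <-≤-trans (0<d R) d≤d′ ; in-len = in-len R ; in-tape = in-tape R
    ; in-var = λ x → <-≤-trans (proj₁ (in-var R x)) d≤d′ , proj₂ (in-var R x) }

  rep-∷ : ∀ {k d r i} {regs ρ : Vec ℕ k} {X} → r < d → X r ≡ i → Represents d regs ρ X →
          Represents d (r ∷ regs) (i ∷ ρ) X
  rep-∷ r<d eq R = record
    { 0<d = 0<d R ; in-len = in-len R ; in-tape = in-tape R
    ; in-var = λ { Fin.zero → r<d , eq ; (Fin.suc x) → in-var R x } }

  record Computes (w : List Bool) (X : Memory) (pc t pc′ d : ℕ) (x : ℕ) : Set where
    constructor computes
    field
      {final} : Memory
      run     : Reaches ⟨ pc , X , w ⟩ t ⟨ pc′ , final , w ⟩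
      result  : final d ≡ x
      frame   : Frame d X final

  -- The bound by `base` keeps the scratch registers of the code clear of the tape.
  Correct : ∀ {k} → Expr k → Set
  Correct {k} e = ∀ {regs ρ : Vec ℕ k} {d pc X w} → Code p pc (compile e regs pc d) →
    Represents d regs ρ X → d + height e ≤ base →
    Computes w X pc (duration e ρ) (pc + size e) d (⟦ e ⟧ ρ)

  copy-correct : ∀ {r v d pc X w} → Code p pc (const d 0 ∷ add d r d ∷ []) → r < d → X r ≡ v → d < base →
                 Computes w X pc 2 (pc + 2) d v
  copy-correct {r} {v} {d} {pc} {X} {w} (f , g , _) r<d eq d<b =
    computes (arriving (+-comm 2 pc) (tick f refl ⨟ tick g refl))
      (trans ([≔]-same (X [ d ≔ 0 ]) d _) (trans (cong₂ _+_ ([≔]-other X 0 (<⇒≢ r<d)) ([≔]-same X d 0))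
        (trans (+-identityʳ _) eq)))
      (frame-trans (frame-set ≤-refl d<b) (frame-set ≤-refl d<b))

  binary-correct : ∀ {k} (a b : Expr k) (op : ℕ → ℕ → ℕ) (ins : ℕ → Instruction) →
    (∀ {d pc X w} → execute (ins d) ⟨ pc , X , w ⟩ ≡ inj₁
      ⟨ suc pc , X [ d ≔ op (X d) (X (suc d)) ] , w ⟩) →
    Correct a → Correct b →
    ∀ {regs ρ : Vec ℕ k} {d pc X w} →
    Code p pc (compile a regs pc d ++ compile b regs (pc + size a) (suc d) ++ ins d ∷ []) →
    Represents d regs ρ X → d + (height a + suc (height b)) ≤ base →
    Computes w X pc (duration a ρ + (duration b ρ + 1)) (pc + (size a + (size b + 1))) d
      (op (⟦ a ⟧ ρ) (⟦ b ⟧ ρ))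
  binary-correct a b op ins ex ca cb {regs} {ρ} {d} {pc} {X} {w} code R high
    with code₁ , code₂ ← code-++ (compile a regs pc d) (length-compile a regs pc d) code
    with code₃ , f , _ ← code-++ (compile b regs (pc + size a) (suc d))
      (length-compile b regs (pc + size a) (suc d)) code₂
    with computes {Y} run₁ res₁ fr₁ ← ca {w = w} code₁ R (≤-trans (+-monoʳ-≤ d (m≤m+n (height a) _)) high)
    with computes {Z} run₂ res₂ fr₂ ← cb {w = w} code₃ (rep-mono (n≤1+n d) (rep-frame R fr₁))
           (≤-trans (≤-reflexive (sym (+-suc d _))) (≤-trans (+-monoʳ-≤ d (m≤n+m _ (height a))) high)) =
    computes
      (arriving pc≡ (run₁ ⨟ run₂ ⨟ tick f ex))
      (trans ([≔]-same Z d _) (cong₂ op (trans (same fr₂ d (inj₁ ≤-refl)) res₁) res₂))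
      (frame-trans (frame-trans fr₁ (frame-mono (n≤1+n d) fr₂)) (frame-set ≤-refl d<b))
    where
    pc≡ : suc (pc + size a + size b) ≡ pc + (size a + (size b + 1))
    pc≡ = trans (+-comm 1 _) (trans (+-assoc (pc + size a) _ 1) (+-assoc pc _ _))
    d<b : d < base
    d<b = <-≤-trans (m<m+n d (≤-trans z<s (m≤n+m _ (height a)))) high

  -- At the entry of the loop, registers d and 1 + d hold the number of
  -- remaining iterations and the sum accumulated so far.
  loop-correct : ∀ {k} (b : Expr (suc k)) → Correct b →
    ∀ {regs ρ : Vec ℕ k} {d pc w js} n {acc X} →
    fetch p pc ≡ const (2 + d) 1 → fetch p (1 + pc) ≡ sub d d (2 + d) →
    Code p (2 + pc) (compile b (d ∷ regs) (2 + pc) (2 + d) ++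
      add (1 + d) (1 + d) (2 + d) ∷ jump d pc ∷ js) →
    Represents d regs ρ X → X d ≡ n → X (1 + d) ≡ acc → 2 + d + height b ≤ base → 2 + d < base →
    Σ[ Y ∈ Memory ] Reaches ⟨ 3 + (pc + size b) , X , w ⟩
                      (∑< n (λ i → 3 + (duration b (i ∷ ρ) + 1)) + 1) ⟨ 4 + (pc + size b) , Y , w ⟩ ×
      Y d ≡ 0 × Y (1 + d) ≡ acc + ∑< n (λ i → ⟦ b ⟧ (i ∷ ρ)) × Frame d X Y
  loop-correct b cb {regs} {ρ} {d} {pc} {w} zero {acc} {X} f₁ f₂ code R Xd Xacc high low
    with _ , _ , f₄ , _ ← code-++ (compile b (d ∷ regs) (2 + pc) (2 + d))
      (length-compile b (d ∷ regs) (2 + pc) (2 + d)) code =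
    X , jump-not-taken f₄ Xd , Xd , trans Xacc (sym (+-identityʳ acc)) , frame-refl
  loop-correct b cb {regs} {ρ} {d} {pc} {w} (suc n) {acc} {X} f₁ f₂ code R Xd Xacc high low
    with code₁ , f₃ , f₄ , _ ← code-++ (compile b (d ∷ regs) (2 + pc) (2 + d))
      (length-compile b (d ∷ regs) (2 + pc) (2 + d)) code
    = body (cb code₁ (rep-∷ (m<n⇒m<1+n ≤-refl) X₂d (rep-mono (m≤n+m d 2) (rep-frame R fr₂))) high)
    where
    X₁ X₂ : Memory
    X₁ = X [ 2 + d ≔ 1 ]
    X₂ = X₁ [ d ≔ X₁ d ∸ X₁ (2 + d) ]
    d<b : d < base
    d<b = <-trans (n<1+n d) (<-trans (n<1+n (suc d)) low)
    X₂d : X₂ d ≡ n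
    X₂d = trans ([≔]-same X₁ d _) (cong₂ _∸_ (trans ([≔]-other X 1 (<⇒≢ (m<n⇒m<1+n ≤-refl))) Xd)
      ([≔]-same X (2 + d) 1))
    X₂acc : X₂ (1 + d) ≡ acc
    X₂acc = trans ([≔]-other X₁ _ (≢-sym (<⇒≢ ≤-refl))) (trans ([≔]-other X 1 (<⇒≢ ≤-refl)) Xacc)
    fr₂ : Frame d X X₂
    fr₂ = frame-trans (frame-set (m≤n+m d 2) low) (frame-set ≤-refl d<b)
    body : Computes w X₂ (2 + pc) (duration b (n ∷ ρ)) (2 + pc + size b) (2 + d) (⟦ b ⟧ (n ∷ ρ)) → _
    body (computes {Y} run res fr)
      with code₁ , f₃ , f₄ , _ ← code-++ (compile b (d ∷ regs) (2 + pc) (2 + d))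
        (length-compile b (d ∷ regs) (2 + pc) (2 + d)) code
      with Z , runZ , Zd , Zacc , frZ ← loop-correct b cb {w = w} n f₁ f₂ code
             (rep-frame R (frame-trans fr₂ (frame-trans (frame-mono (m≤n+m d 2) fr)
               (frame-set (n≤1+n d) (<-trans (n<1+n (suc d)) low)))))
             (trans ([≔]-other Y (Y (1 + d) + Y (2 + d)) (<⇒≢ ≤-refl))
               (trans (same fr d (inj₁ (m<n⇒m<1+n ≤-refl))) X₂d))
             (trans ([≔]-same Y (1 + d) _) (cong₂ _+_ (trans (same fr (1 + d) (inj₁ ≤-refl)) X₂acc)
               res)) high low =
      Z , lasting (sym (+-assoc (3 + (duration b (n ∷ ρ) + 1)) _ 1))
            ((jump-taken f₄ Xd ⨟ tick f₁ refl ⨟ tick f₂ refl ⨟ run ⨟ tick f₃ refl) ⨟ runZ) ,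
      Zd , trans Zacc (+-assoc acc _ _) ,
      frame-trans (frame-trans fr₂ (frame-trans (frame-mono (m≤n+m d 2) fr)
        (frame-set (n≤1+n d) (<-trans (n<1+n (suc d)) low)))) frZ

  sum-correct : ∀ {k} (a : Expr k) (b : Expr (suc k)) → Correct a → Correct b → Correct (sum a b)
  sum-correct a b ca cb {regs} {ρ} {d} {pc} {X} {w} code R high
    with code₁ , _ ← code-++ (compile a regs pc d) (length-compile a regs pc d) code
    = body (ca code₁ R (≤-trans (+-monoʳ-≤ d (m≤m+n (height a) _)) high))
    where
    pcₐ : ℕ
    pcₐ = pc + size a
    high′ : d + (3 + height b) ≤ base
    high′ = ≤-trans (+-monoʳ-≤ d (m≤n+m _ (height a))) high
    low : 2 + d < base
    low = ≤-trans (≤-reflexive (+-comm 3 d)) (≤-trans (+-monoʳ-≤ d (m≤m+n 3 (height b))) high′)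
    low₁ : 1 + d < base
    low₁ = <-trans (n<1+n (1 + d)) low
    high″ : 2 + d + height b ≤ base
    high″ = ≤-trans (≤-trans (n≤1+n _) (≤-reflexive
      (solve 2 (λ d h → con 3 :+ (d :+ h) := d :+ (con 3 :+ h)) refl d (height b)))) high′
      where open +-*-Solver
    pc≡ : 8 + (pcₐ + size b) ≡ pc + size (sum a b)
    pc≡ = solve 3 (λ p a b → con 8 :+ ((p :+ a) :+ b) := p :+ (a :+ (con 5 :+ (b :+ con 3)))) refl
      pc (size a) (size b)
      where open +-*-Solver
    body : Computes w X pc (duration a ρ) pcₐ d (⟦ a ⟧ ρ) →
           Computes w X pc (duration (sum a b) ρ) (pc + size (sum a b)) d (⟦ sum a b ⟧ ρ)
    body (computes {Y} run res fr)
      with code₁ , f₁ , f₂ , f₃ , f₄ , f₅ , code₂ ← code-++ (compile a regs pc d)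
        (length-compile a regs pc d) code
      with _ , _ , _ , f₆ , _ ← code-++ (compile b (d ∷ regs) (5 + pcₐ) (2 + d))
        (length-compile b (d ∷ regs) (5 + pcₐ) (2 + d)) code₂
      with fr₁ ← frame-trans {X = Y} (frame-set {x = 0} ≤-refl low₁)
        (frame-set {x = 1} (n≤1+n (1 + d)) low)
      with Z , runZ , Zd , Zacc , frZ ← loop-correct b cb {w = w} (⟦ a ⟧ ρ) {acc = 0}
        {X = (Y [ 1 + d ≔ 0 ]) [ 2 + d ≔ 1 ]}
             f₄ f₅ code₂ (rep-frame R (frame-trans fr (frame-mono (n≤1+n d) fr₁)))
               (trans (same fr₁ d (inj₁ ≤-refl)) res)
             (trans ([≔]-other (Y [ 1 + d ≔ 0 ]) 1 (<⇒≢ ≤-refl)) ([≔]-same Y (1 + d) 0)) high″ low =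
      computes
        (arriving pc≡ (run ⨟ (tick f₁ refl ⨟ tick f₂ refl ⨟ jump-taken f₃
          ([≔]-same (Y [ 1 + d ≔ 0 ]) (2 + d) 1) ⨟
          lasting (+-assoc _ 1 1) (runZ ⨟ tick f₆ refl))))
        (trans ([≔]-same Z d _) (trans (cong₂ _+_ Zacc Zd) (+-identityʳ _)))
        (frame-trans fr (frame-trans (frame-mono (n≤1+n d) fr₁) (frame-trans frZ
          (frame-set ≤-refl (<-trans (n<1+n d) low₁)))))

  cell-correct : ∀ {k} (a : Expr k) → Correct a → Correct (cell a)
  cell-correct a ca {regs} {ρ} {d} {pc} {X} {w} code R high
    with code₁ , f₁ , f₂ , f₃ , _ ← code-++ (compile a regs pc d) (length-compile a regs pc d) code
    with computes {Y} run res fr ← ca {w = w} code₁ R (≤-trans (+-monoʳ-≤ d (m≤m+n (height a) 2)) high) =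
    computes (arriving pc≡ (run ⨟ tick f₁ refl ⨟ tick f₂ refl ⨟ tick f₃ refl))
      (trans ([≔]-same Y₂ d _) (trans (cong Y₂ Y₂d) (trans (same fr₂ _ (inj₂ (m≤m+n base _)))
        (trans (same fr _ (inj₂ (m≤m+n base _))) (in-tape R _)))))
      (frame-trans (frame-trans fr fr₂) (frame-set ≤-refl d<b))
    where
    low : 1 + d < base
    low = ≤-trans (≤-reflexive (+-comm 2 d)) (≤-trans (+-monoʳ-≤ d (m≤n+m 2 (height a))) high)
    d<b : d < base
    d<b = <-trans (n<1+n d) low
    Y₁ Y₂ : Memory
    Y₁ = Y [ suc d ≔ base ]
    Y₂ = Y₁ [ d ≔ Y₁ d + Y₁ (suc d) ]
    Y₂d : Y₂ d ≡ base + ⟦ a ⟧ ρ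
    Y₂d = trans ([≔]-same Y₁ d _) (trans
      (cong₂ _+_ (trans ([≔]-other Y base (<⇒≢ ≤-refl)) res) ([≔]-same Y (suc d) base))
      (+-comm _ base))
    fr₂ : Frame d Y Y₂
    fr₂ = frame-trans (frame-set (n≤1+n d) low) (frame-set ≤-refl d<b)
    pc≡ : 3 + (pc + size a) ≡ pc + (size a + 3)
    pc≡ = trans (+-comm 3 _) (+-assoc pc (size a) 3)

  compile-correct : ∀ {k} (e : Expr k) → Correct e
  compile-correct (lit c) {regs} {ρ} {d} {pc} {X} (f , _) R high =
    computes (arriving (+-comm 1 pc) (tick f refl)) ([≔]-same X d c)
      (frame-set ≤-refl (≤-trans (≤-reflexive (+-comm 1 d)) high))
  compile-correct (var x) {d = d} code R high =
    copy-correct code (proj₁ (in-var R x)) (proj₂ (in-var R x)) (≤-trans (≤-reflexive (+-comm 1 d)) high)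
  compile-correct len {d = d} code R high =
    copy-correct code (0<d R) (in-len R) (≤-trans (≤-reflexive (+-comm 1 d)) high)
  compile-correct (a ⊕ b) =
    binary-correct a b _+_ (λ d → add d d (suc d)) refl (compile-correct a) (compile-correct b)
  compile-correct (a ⊖ b) =
    binary-correct a b _∸_ (λ d → sub d d (suc d)) refl (compile-correct a) (compile-correct b)
  compile-correct (cell a)  = cell-correct a (compile-correct a)
  compile-correct (sum a b) = sum-correct a b (compile-correct a) (compile-correct b)

-- Programs that decide formulas

infix  5 _≼_ _≐_
infix  4 ¬̇_
infixr 3 _∧̇_
infixr 2 _∨̇_
infixr 1 _⇒̇_

data Formula (k : ℕ) : Set where
  _≼_ _≐_ : Expr k → Expr k → Formula k
  ¬̇_ : Formula k → Formula k
  _∧̇_ _∨̇_ _⇒̇_ : Formula k → Formula k → Formula k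
  all< ex< : Expr k → Formula (suc k) → Formula k

-- The value 0 stands for truth.
check : ∀ {k} → Formula k → Expr k
check (a ≼ b)    = a ⊖ b
check (a ≐ b)    = (a ⊖ b) ⊕ (b ⊖ a)
check (¬̇ φ)      = lit 1 ⊖ check φ
check (φ ∧̇ ψ)    = check φ ⊕ check ψ
-- Truncated subtraction from 1 sends 0 to 1 and all other values to 0. Hence the 1 in front
-- survives both subtractions only if neither disjunct is true; in an implication it survives only
-- if the premise is true and the conclusion is not.
check (φ ∨̇ ψ)    = lit 1 ⊖ (lit 1 ⊖ check ψ) ⊖ (lit 1 ⊖ check φ)
check (φ ⇒̇ ψ)    = lit 1 ⊖ (lit 1 ⊖ check ψ) ⊖ check φ
check (all< b φ) = sum b (check φ)
check (ex< b φ)  = lit 1 ⊖ sum b (lit 1 ⊖ check φ)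

∑<-zero⁻ : ∀ m {f} → ∑< m f ≡ 0 → ∀ i → i < m → f i ≡ 0
∑<-zero⁻ (suc m) {f} eq i i<1+m with m≤n⇒m<n∨m≡n i<1+m
... | inj₁ (s≤s i<m) = ∑<-zero⁻ m (m+n≡0⇒n≡0 (f m) eq) i i<m
... | inj₂ refl      = m+n≡0⇒m≡0 (f m) eq

∑<-zero⁺ : ∀ m {f} → (∀ i → i < m → f i ≡ 0) → ∑< m f ≡ 0
∑<-zero⁺ zero    eq = refl
∑<-zero⁺ (suc m) eq = cong₂ _+_ (eq m ≤-refl) (∑<-zero⁺ m (λ i i<m → eq i (m<n⇒m<1+n i<m)))

∑<-≤ : ∀ m {f c} → (∀ i → i < m → f i ≤ c) → ∑< m f ≤ m * c
∑<-≤ zero    f≤ = z≤n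
∑<-≤ (suc m) f≤ = +-mono-≤ (f≤ m ≤-refl) (∑<-≤ m (λ i i<m → f≤ i (m<n⇒m<1+n i<m)))

1∸n≡0⇒n≢0 : ∀ {n} → 1 ∸ n ≡ 0 → n ≢ 0
1∸n≡0⇒n≢0 {suc n} _ ()

n≢0⇒1∸n≡0 : ∀ {n} → n ≢ 0 → 1 ∸ n ≡ 0
n≢0⇒1∸n≡0 {zero}  n≢0 = contradiction refl n≢0
n≢0⇒1∸n≡0 {suc n} _   = 0∸n≡0 n

module Satisfaction (L : ℕ) (tape : ℕ → ℕ) where

  open Semantics L tape

  infix 0 _⊨_
  _⊨_ : ∀ {k} → Vec ℕ k → Formula k → Set
  ρ ⊨ a ≼ b    = ⟦ a ⟧ ρ ≤ ⟦ b ⟧ ρ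
  ρ ⊨ a ≐ b    = ⟦ a ⟧ ρ ≡ ⟦ b ⟧ ρ
  ρ ⊨ ¬̇ φ      = ¬ (ρ ⊨ φ)
  ρ ⊨ φ ∧̇ ψ    = (ρ ⊨ φ) × (ρ ⊨ ψ)
  ρ ⊨ φ ∨̇ ψ    = (ρ ⊨ φ) ⊎ (ρ ⊨ ψ)
  ρ ⊨ φ ⇒̇ ψ    = (ρ ⊨ φ) → (ρ ⊨ ψ)
  ρ ⊨ all< b φ = ∀ i → i < ⟦ b ⟧ ρ → i ∷ ρ ⊨ φ
  ρ ⊨ ex< b φ  = ∃[ i ] i < ⟦ b ⟧ ρ × (i ∷ ρ ⊨ φ)

  check-sound    : ∀ {k} (φ : Formula k) ρ → ⟦ check φ ⟧ ρ ≡ 0 → ρ ⊨ φ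
  check-complete : ∀ {k} (φ : Formula k) ρ → ρ ⊨ φ → ⟦ check φ ⟧ ρ ≡ 0

  check-sound (a ≼ b) ρ eq = m∸n≡0⇒m≤n eq
  check-sound (a ≐ b) ρ eq = ≤-antisym (m∸n≡0⇒m≤n (m+n≡0⇒m≡0 _ eq))
                               (m∸n≡0⇒m≤n (m+n≡0⇒n≡0 (⟦ a ⟧ ρ ∸ ⟦ b ⟧ ρ) eq))
  check-sound (¬̇ φ) ρ eq h = 1∸n≡0⇒n≢0 eq (check-complete φ ρ h)
  check-sound (φ ∧̇ ψ) ρ eq = check-sound φ ρ (m+n≡0⇒m≡0 _ eq) ,
                             check-sound ψ ρ (m+n≡0⇒n≡0 (⟦ check φ ⟧ ρ) eq)
  check-sound (φ ∨̇ ψ) ρ eq with ⟦ check φ ⟧ ρ in e₁ | ⟦ check ψ ⟧ ρ in e₂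
  ... | zero  | _     = inj₁ (check-sound φ ρ e₁)
  ... | suc _ | zero  = inj₂ (check-sound ψ ρ e₂)
  ... | suc m | suc n = contradiction eq
    (λ e → 1+n≢0 (trans (sym (cong₂ (λ x y → (1 ∸ x) ∸ y) (0∸n≡0 n) (0∸n≡0 m))) e))
  check-sound (φ ⇒̇ ψ) ρ eq h with ⟦ check φ ⟧ ρ | check-complete φ ρ h | ⟦ check ψ ⟧ ρ in e₂
  ... | _ | refl | zero  = check-sound ψ ρ e₂
  ... | _ | refl | suc n = contradiction (trans (sym (cong (1 ∸_) (0∸n≡0 n))) eq) 1+n≢0
  check-sound (all< b φ) ρ eq i i<b = check-sound φ (i ∷ ρ) (∑<-zero⁻ (⟦ b ⟧ ρ) eq i i<b)
  check-sound (ex< b φ) ρ eq = search (⟦ b ⟧ ρ) (1∸n≡0⇒n≢0 eq)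
    where
    search : ∀ m → ∑< m (λ i → 1 ∸ ⟦ check φ ⟧ (i ∷ ρ)) ≢ 0 → ∃[ i ] i < m × (i ∷ ρ ⊨ φ)
    search zero    neq = contradiction refl neq
    search (suc m) neq with ⟦ check φ ⟧ (m ∷ ρ) in e
    ... | zero  = m , ≤-refl , check-sound φ (m ∷ ρ) e
    ... | suc x with i , i<m , h ← search m (λ e → neq (cong₂ _+_ (0∸n≡0 x) e)) =
      i , m<n⇒m<1+n i<m , h

  check-complete (a ≼ b) ρ h = m≤n⇒m∸n≡0 h
  check-complete (a ≐ b) ρ h = cong₂ _+_ (m≤n⇒m∸n≡0 (≤-reflexive h)) (m≤n⇒m∸n≡0 (≤-reflexive (sym h)))
  check-complete (¬̇ φ) ρ h = n≢0⇒1∸n≡0 (h ∘ check-sound φ ρ)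
  check-complete (φ ∧̇ ψ) ρ (h , h′) = cong₂ _+_ (check-complete φ ρ h) (check-complete ψ ρ h′)
  check-complete (φ ∨̇ ψ) ρ (inj₁ h) rewrite check-complete φ ρ h =
    m≤n⇒m∸n≡0 (m∸n≤m 1 (1 ∸ ⟦ check ψ ⟧ ρ))
  check-complete (φ ∨̇ ψ) ρ (inj₂ h) rewrite check-complete ψ ρ h = 0∸n≡0 (1 ∸ ⟦ check φ ⟧ ρ)
  check-complete (φ ⇒̇ ψ) ρ h with ⟦ check φ ⟧ ρ in e₁
  ... | zero rewrite check-complete ψ ρ (h (check-sound φ ρ e₁)) = refl
  ... | suc m = m≤n⇒m∸n≡0 (≤-trans (m∸n≤m 1 (1 ∸ ⟦ check ψ ⟧ ρ)) (s≤s z≤n))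
  check-complete (all< b φ) ρ h = ∑<-zero⁺ (⟦ b ⟧ ρ) (λ i i<b → check-complete φ (i ∷ ρ) (h i i<b))
  check-complete (ex< b φ) ρ (i , i<b , h) = n≢0⇒1∸n≡0 λ eq →
    1∸n≡0⇒n≢0 (∑<-zero⁻ (⟦ b ⟧ ρ) eq i i<b) (check-complete φ (i ∷ ρ) h)

  check-correct : ∀ {k} (φ : Formula k) ρ → (⟦ check φ ⟧ ρ ≡ 0) ⇔ (ρ ⊨ φ)
  check-correct φ ρ = mk⇔ (check-sound φ ρ) (check-complete φ ρ)

-- Polynomial bounds are kept in the form (2 + n) ^ k, which is closed
-- under sums, products and composition.
Polynomial : (ℕ → ℕ) → Set
Polynomial f = ∃[ k ] ∀ n → f n ≤ (2 + n) ^ k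

n<2^n : ∀ n → n < 2 ^ n
n<2^n zero    = z<s
n<2^n (suc n) = +-mono-≤ (≤-trans (s≤s z≤n) (n<2^n n)) (≤-trans (n<2^n n) (m≤m+n (2 ^ n) 0))

polynomial-const : ∀ c → Polynomial (λ _ → c)
polynomial-const c = c , λ n → ≤-trans (<⇒≤ (n<2^n c)) (^-monoˡ-≤ c (m≤m+n 2 n))

polynomial-id : Polynomial id
polynomial-id = 1 , λ n → ≤-trans (m≤n+m n 2) (≤-reflexive (sym (*-identityʳ (2 + n))))

polynomial-* : ∀ {f g} → Polynomial f → Polynomial g → Polynomial (λ n → f n * g n)
polynomial-* (k , f≤) (l , g≤) = k + l , λ n →
  ≤-trans (*-mono-≤ (f≤ n) (g≤ n)) (≤-reflexive (sym (^-distribˡ-+-* (2 + n) k l)))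

polynomial-+ : ∀ {f g} → Polynomial f → Polynomial g → Polynomial (λ n → f n + g n)
polynomial-+ (k , f≤) (l , g≤) = suc (k + l) , λ n → ≤-trans
  (+-mono-≤ (≤-trans (f≤ n) (^-monoʳ-≤ (2 + n) (m≤m+n k l)))
    (≤-trans (g≤ n) (^-monoʳ-≤ (2 + n) (m≤n+m l k))))
  (≤-trans (≤-reflexive (cong ((2 + n) ^ (k + l) +_) (sym (+-identityʳ _))))
    (*-monoˡ-≤ ((2 + n) ^ (k + l)) (m≤m+n 2 n)))

polynomial-∘ : ∀ {f g} → Polynomial f → Polynomial g → Polynomial (f ∘ g)
polynomial-∘ {f} {g} (k , f≤) pg with l , g≤ ← polynomial-+ (polynomial-const 2) pg =
  l * k , λ n → ≤-trans (f≤ (g n)) (≤-trans (^-monoˡ-≤ k (g≤ n)) (≤-reflexive (^-*-assoc (2 + n) l k)))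

^-distribˡ-* : ∀ m n k → (m * n) ^ k ≡ m ^ k * n ^ k
^-distribˡ-* m n zero    = refl
^-distribˡ-* m n (suc k) = trans (cong (m * n *_) (^-distribˡ-* m n k))
  ([m*n]*[o*p]≡[m*o]*[n*p] m n (m ^ k) (n ^ k))

standard-form : ∀ {f} → Polynomial f → ∃[ c ] ∃[ k ] ∀ n → f n ≤ c * n ^ k + c
standard-form {f} (k , f≤) = 3 ^ k , k , λ n → ≤-trans (f≤ n) (bound n)
  where
  -- For positive n the sum 2 + n is at most 3 * n; at n = 0 the additive constant suffices.
  bound : ∀ n → (2 + n) ^ k ≤ 3 ^ k * n ^ k + 3 ^ k
  bound zero    = ≤-trans (^-monoˡ-≤ k (n≤1+n 2)) (m≤n+m (3 ^ k) _)
  bound (suc n) = ≤-trans (≤-trans (^-monoˡ-≤ k 3+n≤) (≤-reflexive (^-distribˡ-* 3 (suc n) k)))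
    (m≤m+n _ (3 ^ k))
    where
    3+n≤ : 3 + n ≤ 3 * suc n
    3+n≤ = ≤-trans (+-monoʳ-≤ 3 (m≤m+n n _)) (≤-reflexive (sym (*-suc 3 n)))

-- B is meant to bound the input length, the tape cells and the variables. In the body of a sum the
-- new variable lies below the value of the range, which is therefore added to B.
valueBound timeBound : ∀ {k} → Expr k → ℕ → ℕ
valueBound (lit c)   B = c
valueBound (var x)   B = B
valueBound len       B = B
valueBound (a ⊕ b)   B = valueBound a B + valueBound b B
valueBound (a ⊖ b)   B = valueBound a B
valueBound (cell a)  B = B
valueBound (sum a b) B = valueBound a B * valueBound b (B + valueBound a B)

timeBound (lit c)   B = 1
timeBound (var x)   B = 2
timeBound len       B = 2
timeBound (a ⊕ b)   B = timeBound a B + (timeBound b B + 1)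
timeBound (a ⊖ b)   B = timeBound a B + (timeBound b B + 1)
timeBound (cell a)  B = timeBound a B + 3
timeBound (sum a b) B =
  timeBound a B + (3 + (valueBound a B * (3 + (timeBound b (B + valueBound a B) + 1)) + 2))

valueBound-polynomial : ∀ {k} (e : Expr k) → Polynomial (valueBound e)
valueBound-polynomial (lit c)   = polynomial-const c
valueBound-polynomial (var x)   = polynomial-id
valueBound-polynomial len       = polynomial-id
valueBound-polynomial (a ⊕ b)   = polynomial-+ (valueBound-polynomial a) (valueBound-polynomial b)
valueBound-polynomial (a ⊖ b)   = valueBound-polynomial a
valueBound-polynomial (cell a)  = polynomial-id
valueBound-polynomial (sum a b) = polynomial-* (valueBound-polynomial a)
  (polynomial-∘ (valueBound-polynomial b) (polynomial-+ polynomial-id (valueBound-polynomial a)))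

timeBound-polynomial : ∀ {k} (e : Expr k) → Polynomial (timeBound e)
timeBound-polynomial (lit c)   = polynomial-const 1
timeBound-polynomial (var x)   = polynomial-const 2
timeBound-polynomial len       = polynomial-const 2
timeBound-polynomial (a ⊕ b)   = polynomial-+ (timeBound-polynomial a)
  (polynomial-+ (timeBound-polynomial b) (polynomial-const 1))
timeBound-polynomial (a ⊖ b)   = polynomial-+ (timeBound-polynomial a)
  (polynomial-+ (timeBound-polynomial b) (polynomial-const 1))
timeBound-polynomial (cell a)  = polynomial-+ (timeBound-polynomial a) (polynomial-const 3)
timeBound-polynomial (sum a b) = polynomial-+ (timeBound-polynomial a) (polynomial-+ (polynomial-const 3)
  (polynomial-+ (polynomial-* (valueBound-polynomial a) (polynomial-+ (polynomial-const 3) (polynomial-+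
    (polynomial-∘ (timeBound-polynomial b) (polynomial-+ polynomial-id (valueBound-polynomial a)))
    (polynomial-const 1)))) (polynomial-const 2)))

module Bounds (L : ℕ) (tape : ℕ → ℕ) where

  open Semantics L tape

  bounded : ∀ {k} (e : Expr k) {ρ : Vec ℕ k} {B} → L ≤ B → (∀ i → tape i ≤ B) → (∀ x → lookup ρ x ≤ B) →
            ⟦ e ⟧ ρ ≤ valueBound e B × duration e ρ ≤ timeBound e B
  bounded (lit c)  L≤ t≤ ρ≤ = ≤-refl , ≤-refl
  bounded (var x)  L≤ t≤ ρ≤ = ρ≤ x , ≤-refl
  bounded len      L≤ t≤ ρ≤ = L≤ , ≤-refl
  bounded (a ⊕ b)  L≤ t≤ ρ≤ with va , ta ← bounded a L≤ t≤ ρ≤ | vb , tb ← bounded b L≤ t≤ ρ≤ =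
    +-mono-≤ va vb , +-mono-≤ ta (+-monoˡ-≤ 1 tb)
  bounded (a ⊖ b) {ρ} L≤ t≤ ρ≤ with va , ta ← bounded a L≤ t≤ ρ≤ | vb , tb ← bounded b L≤ t≤ ρ≤ =
    ≤-trans (m∸n≤m (⟦ a ⟧ ρ) (⟦ b ⟧ ρ)) va , +-mono-≤ ta (+-monoˡ-≤ 1 tb)
  bounded (cell a) L≤ t≤ ρ≤ with _ , ta ← bounded a L≤ t≤ ρ≤ = t≤ _ , +-monoˡ-≤ 3 ta
  bounded (sum a b) {ρ} {B} L≤ t≤ ρ≤ with va , ta ← bounded a L≤ t≤ ρ≤ =
    ≤-trans (∑<-≤ (⟦ a ⟧ ρ) (λ i i< → proj₁ (body i i<))) (*-monoˡ-≤ _ va) ,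
    +-mono-≤ ta (+-monoʳ-≤ 3 (+-monoˡ-≤ 2 (≤-trans
      (∑<-≤ (⟦ a ⟧ ρ) (λ i i< → +-monoʳ-≤ 3 (+-monoˡ-≤ 1 (proj₂ (body i i<))))) (*-monoˡ-≤ _ va))))
    where
    body : ∀ i → i < ⟦ a ⟧ ρ → ⟦ b ⟧ (i ∷ ρ) ≤ valueBound b (B + valueBound a B) ×
                               duration b (i ∷ ρ) ≤ timeBound b (B + valueBound a B)
    body i i< = bounded b (m≤n⇒m≤n+o _ L≤) (λ j → m≤n⇒m≤n+o _ (t≤ j))
      λ { Fin.zero → ≤-trans (<⇒≤ i<) (≤-trans (proj₁ (bounded a L≤ t≤ ρ≤)) (m≤n+m _ B))
        ; (Fin.suc x) → m≤n⇒m≤n+o _ (ρ≤ x) }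

-- The deciding program and its running time

inputTape : List Bool → ℕ → ℕ
inputTape []      _       = 0
inputTape (b ∷ w) zero    = symbol (b ∷ w)
inputTape (b ∷ w) (suc i) = inputTape w i

inputTape≤1 : ∀ w i → inputTape w i ≤ 1
inputTape≤1 []          i       = z≤n
inputTape≤1 (false ∷ w) zero    = z≤n
inputTape≤1 (true ∷ w)  zero    = ≤-refl
inputTape≤1 (b ∷ w)     (suc i) = inputTape≤1 w i

code-∷ : ∀ {i p pc} is → Code p pc is → Code (i ∷ p) (suc pc) is
code-∷ []       c       = tt
code-∷ (_ ∷ is) (f , c) = f , code-∷ is c

code-self : ∀ p → Code p 0 p
code-self []      = tt
code-self (i ∷ p) = refl , code-∷ p (code-self p)

≡ᵇ-+ : ∀ k i j → (k + i ≡ᵇ k + j) ≡ (i ≡ᵇ j)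
≡ᵇ-+ zero    i j = refl
≡ᵇ-+ (suc k) i j = ≡ᵇ-+ k i j

-- The program copies its input to the tape, appends as many cells as the
-- expression count says, the one at position m being 1 or 0 according to
-- whether the formula φ holds for m, and finally decides the formula ψ.
module Main (count : Expr 0) (φ : Formula 1) (ψ : Formula 0) where

  -- The formula is evaluated on the tape as it stands at that moment, so a cell may depend on the
  -- cells filled before it.
  filled : ℕ → ℕ → ℕ → (ℕ → ℕ) → ℕ → ℕ
  filled L zero    m tape = tape
  filled L (suc c) m tape = filled L c (suc m) (tape [ m ≔ 1 ∸ Semantics.⟦_⟧ L tape (check φ) (m ∷ []) ])

  outputTape : List Bool → ℕ → ℕ
  outputTape w = filled L (Semantics.⟦_⟧ L (inputTape w) count []) L (inputTape w)
    where L = length w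

  s₁ s₂ s₃ base : ℕ
  s₁ = size count
  s₂ = size (check φ)
  s₃ = size (check ψ)
  -- Registers 0 to 5 serve the program itself; the heights leave room for each of the three
  -- compiled expressions.
  base = 6 + (height count + (height (check φ) + height (check ψ)))

  open Compiler base

  code₀ code₁ code₂ code₃ : List Instruction
  -- While cells are appended, register 1 holds the position of the next one
  -- and register 2 the number of those that remain.
  code₀ =
    const 1 1 ∷ jump 1 6 ∷
    const 3 base ∷ add 3 3 0 ∷ store 3 2 ∷ add 0 0 1 ∷
    -- Subtracting the symbol from 2 leaves 0 only at the end marker; after a bit control returns to
    -- address 2, where the bit is stored.
    read 2 ∷ const 3 2 ∷ sub 3 3 2 ∷ jump 3 2 ∷
    const 1 0 ∷ add 1 1 0 ∷ code₁
  code₁ = compile count [] 12 2 ++ const 3 1 ∷ jump 3 (21 + (s₁ + s₂)) ∷ code₂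
  code₂ = compile (check φ) (1 ∷ []) (14 + s₁) 3 ++
    const 4 1 ∷ sub 3 4 3 ∷ const 5 base ∷ add 5 5 1 ∷ store 5 3 ∷ add 1 1 4 ∷ sub 2 2 4 ∷
    jump 2 (14 + s₁) ∷ code₃
  code₃ = compile (check ψ) [] (22 + (s₁ + s₂)) 2 ++ jump 2 (24 + (s₁ + s₂ + s₃)) ∷ accept ∷ reject ∷ []

  open Execution code₀

  -- The memory after one round of reading, written exactly as the instructions compute it, so that
  -- the single steps hold by `refl`.
  scratch stored : ℕ → Memory → Memory
  scratch x X = ((((X [ 2 ≔ x ]) [ 3 ≔ 2 ]) [ 3 ≔ 2 ∸ x ]) [ 3 ≔ base ]) [ 3 ≔ base + X 0 ]
  stored x X = (scratch x X [ base + X 0 ≔ x ]) [ 0 ≔ X 0 + X 1 ]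

  stored-same : ∀ x X → stored x X (base + X 0) ≡ x
  stored-same x X = [≔]-same (scratch x X) (base + X 0) x

  stored-other : ∀ x X {j} → j ≢ X 0 → stored x X (base + j) ≡ X (base + j)
  stored-other x X {j} j≢ =
    [≔]-other (scratch x X) {base + X 0} {base + j} x (j≢ ∘ +-cancelˡ-≡ base j (X 0))

  store-run : ∀ b w X → Reaches ⟨ 6 , X , b ∷ w ⟩ 8 ⟨ 6 , stored (symbol (b ∷ w)) X , w ⟩
  store-run false w X = tick refl refl ⨟ tick refl refl ⨟ tick refl refl ⨟ jump-taken refl refl ⨟
    tick refl refl ⨟ tick refl refl ⨟ tick refl refl ⨟ tick refl refl
  store-run true w X = tick refl refl ⨟ tick refl refl ⨟ tick refl refl ⨟ jump-taken refl refl ⨟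
    tick refl refl ⨟ tick refl refl ⨟ tick refl refl ⨟ tick refl refl

  read-correct : ∀ w X → X 1 ≡ 1 → (∀ j → X 0 ≤ j → X (base + j) ≡ 0) →
    Σ[ Y ∈ Memory ] Reaches ⟨ 6 , X , w ⟩ (length w * 8 + 4) ⟨ 10 , Y , [] ⟩ ×
      Y 0 ≡ X 0 + length w × (∀ j → j < X 0 → Y (base + j) ≡ X (base + j)) ×
      (∀ j → Y (base + (X 0 + j)) ≡ inputTape w j)
  read-correct [] X X1 blank =
    ((X [ 2 ≔ 2 ]) [ 3 ≔ 2 ]) [ 3 ≔ 0 ] ,
    (tick refl refl ⨟ tick refl refl ⨟ tick refl refl ⨟ jump-not-taken refl refl) ,
    sym (+-identityʳ (X 0)) , (λ _ _ → refl) , λ j → blank (X 0 + j) (m≤m+n (X 0) j)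
  read-correct (b ∷ w) X X1 blank = prepend (read-correct w (stored x X) X1 blank′)
    where
    x : ℕ
    x = symbol (b ∷ w)
    next : X 0 + X 1 ≡ suc (X 0)
    next = trans (cong (X 0 +_) X1) (+-comm (X 0) 1)
    blank′ : ∀ j → X 0 + X 1 ≤ j → stored x X (base + j) ≡ 0
    blank′ j le = trans (stored-other x X (≢-sym (<⇒≢ lt))) (blank j (<⇒≤ lt))
      where
      lt : X 0 < j
      lt = ≤-trans (≤-reflexive (sym next)) le
    prepend : (Σ[ Y ∈ Memory ] Reaches ⟨ 6 , stored x X , w ⟩ (length w * 8 + 4) ⟨ 10 , Y , [] ⟩ ×
        Y 0 ≡ X 0 + X 1 + length w × (∀ j → j < X 0 + X 1 → Y (base + j) ≡ stored x X (base + j)) ×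
        (∀ j → Y (base + (X 0 + X 1 + j)) ≡ inputTape w j)) → _
    prepend (Y , run , Y0 , old , new) =
      Y , (store-run b w X ⨟ run) , trans Y0
        (trans (cong (_+ length w) next) (sym (+-suc (X 0) (length w)))) ,
      (λ j j< → trans (old j (≤-trans j< (m≤m+n (X 0) (X 1)))) (stored-other x X (<⇒≢ j<))) , new′
      where
      new′ : ∀ j → Y (base + (X 0 + j)) ≡ inputTape (b ∷ w) j
      new′ zero    = trans (cong (λ i → Y (base + i)) (+-identityʳ (X 0)))
        (trans (old (X 0) (≤-reflexive (sym next))) (stored-same x X))
      new′ (suc j) = trans (cong (λ i → Y (base + i))
        (trans (+-suc (X 0) j) (cong (_+ j) (sym next)))) (new j)

  store-tape : ∀ {Y tape a m x v} → a ≡ base + m → x ≡ v → (∀ i → Y (base + i) ≡ tape i) →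
               ∀ i → (Y [ a ≔ x ]) (base + i) ≡ (tape [ m ≔ v ]) i
  store-tape {m = m} {x} refl refl eq i = cong₂ (λ c y → if c then x else y) (≡ᵇ-+ base i m) (eq i)

  -- A round consists of the test, the evaluation of the formula and seven further instructions.
  fillBound : ℕ → ℕ
  fillBound B = timeBound (check φ) B + 8

  module _ (L : ℕ) where

    Fills : ℕ → ℕ → (ℕ → ℕ) → Memory → ℕ → Set
    Fills c m tape X B =
      Σ[ Y ∈ Memory ] Σ[ t ∈ ℕ ] t ≤ c * fillBound B + 1 ×
        Reaches ⟨ 21 + (s₁ + s₂) , X , [] ⟩ t ⟨ 22 + (s₁ + s₂) , Y , [] ⟩ ×
        Y 0 ≡ L × (∀ i → Y (base + i) ≡ filled L c m tape i) × (∀ i → filled L c m tape i ≤ 1)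

    fill-correct : ∀ c {m tape X B} → Code code₀ (14 + s₁) code₂ → L ≤ B → m + c ≤ B → 1 ≤ B →
      (∀ i → tape i ≤ 1) →
      X 0 ≡ L → X 1 ≡ m → X 2 ≡ c → (∀ i → X (base + i) ≡ tape i) →
      Fills c m tape X B
    fill-correct zero {X = X} code L≤ m≤ 1≤ t≤ X0 X1 X2 Xt
      with _ , _ , _ , _ , _ , _ , _ , _ , f , _ ← code-++ (compile (check φ) (1 ∷ []) (14 + s₁) 3)
             (length-compile (check φ) (1 ∷ []) (14 + s₁) 3) code =
      X , 1 , ≤-refl , jump-not-taken f X2 , X0 , Xt , t≤
    fill-correct (suc c) {m} {tape} {X} {B} code L≤ m≤ 1≤ t≤ X0 X1 X2 Xt
      with code₁ , f₁ , f₂ , f₃ , f₄ , f₅ , f₆ , f₇ , f₈ , _ ← code-++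
        (compile (check φ) (1 ∷ []) (14 + s₁) 3)
             (length-compile (check φ) (1 ∷ []) (14 + s₁) 3) code =
      body (compile-correct (check φ) code₁ R high)
      where
      open Correctness base L tape code₀
      open Semantics L tape
      R : Represents 3 (1 ∷ []) (m ∷ []) X
      R = record { 0<d = z<s ; in-len = X0 ; in-tape = Xt ; in-var = λ { Fin.zero → s≤s (s≤s z≤n) , X1 } }
      high : 3 + height (check φ) ≤ base
      high = +-mono-≤ (m≤m+n 3 3) (m≤n⇒m≤o+n (height count) (m≤m+n _ _))
      value : ℕ
      value = 1 ∸ ⟦ check φ ⟧ (m ∷ [])
      time≤ : duration (check φ) (m ∷ []) ≤ timeBound (check φ) B
      time≤ = proj₂ (Bounds.bounded L tape (check φ) L≤ (λ i → ≤-trans (t≤ i) 1≤)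
        λ { Fin.zero → ≤-trans (m≤m+n m (suc c)) m≤ })
      total : ∀ {t} → t ≤ c * fillBound B + 1 →
              suc (duration (check φ) (m ∷ []) + (7 + t)) ≤ suc c * fillBound B + 1
      total {t} t≤ = ≤-trans (s≤s (+-mono-≤ time≤ (+-monoʳ-≤ 7 t≤)))
        (≤-reflexive (solve 2 (λ b r → con 1 :+ (b :+ (con 7 :+ (r :+ con 1))) :=
          ((b :+ con 8) :+ r) :+ con 1)
          refl (timeBound (check φ) B) (c * fillBound B)))
        where open +-*-Solver
      body : Computes [] X (14 + s₁) (duration (check φ) (m ∷ [])) (14 + s₁ + s₂) 3
        (⟦ check φ ⟧ (m ∷ [])) →
             Fills (suc c) m tape X B
      body (computes {Y} run res fr) = finish (code-++ (compile (check φ) (1 ∷ []) (14 + s₁) 3)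
          (length-compile (check φ) (1 ∷ []) (14 + s₁) 3) code)
        (fill-correct c {suc m} {tape [ m ≔ value ]} {Y₇} code L≤
          (≤-trans (≤-reflexive (sym (+-suc m c))) m≤) 1≤
          value≤1 (trans (same fr 0 (inj₁ z<s)) X0)
          (trans (+-comm (Y 1) 1) (cong suc Y1)) (cong (_∸ 1) (trans (same fr 2 (inj₁ ≤-refl)) X2))
          (store-tape {Y = Y₄} (cong (base +_) Y1) (cong (1 ∸_) res)
            (λ i → trans (same fr (base + i) (inj₂ (m≤m+n base i))) (Xt i))))
        where
        Y₄ Y₇ : Memory
        Y₄ = (((Y [ 4 ≔ 1 ]) [ 3 ≔ 1 ∸ Y 3 ]) [ 5 ≔ base ]) [ 5 ≔ base + Y 1 ]
        Y₇ = ((Y₄ [ base + Y 1 ≔ 1 ∸ Y 3 ]) [ 1 ≔ Y 1 + 1 ]) [ 2 ≔ Y 2 ∸ 1 ]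
        Y1 : Y 1 ≡ m
        Y1 = trans (same fr 1 (inj₁ (s≤s (s≤s z≤n)))) X1
        value≤1 : ∀ i → (tape [ m ≔ value ]) i ≤ 1
        value≤1 i with i ≡ᵇ m
        ... | true  = m∸n≤m 1 (⟦ check φ ⟧ (m ∷ []))
        ... | false = t≤ i
        finish : Code code₀ (14 + s₁) (compile (check φ) (1 ∷ []) (14 + s₁) 3) ×
            Code code₀ (14 + s₁ + s₂) (const 4 1 ∷ sub 3 4 3 ∷ const 5 base ∷ add 5 5 1 ∷ store 5 3 ∷
              add 1 1 4 ∷ sub 2 2 4 ∷ jump 2 (14 + s₁) ∷ code₃) →
          Fills c (suc m) (tape [ m ≔ value ]) Y₇ B → Fills (suc c) m tape X B
        finish (_ , f₁ , f₂ , f₃ , f₄ , f₅ , f₆ , f₇ , f₈ , _) (Z , t , t≤ , runZ , Z0 , Zt , Z≤) =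
          Z , _ , total t≤ ,
          (jump-taken f₈ X2 ⨟ run ⨟ tick f₁ refl ⨟ tick f₂ refl ⨟ tick f₃ refl ⨟ tick f₄ refl ⨟
           tick f₅ refl ⨟ tick f₆ refl ⨟ tick f₇ refl ⨟ runZ) , Z0 , Zt , Z≤

  cellsBound workspace timeTotal : ℕ → ℕ
  cellsBound ℓ = valueBound count (1 + ℓ)
  workspace ℓ = 1 + ℓ + cellsBound ℓ
  timeTotal ℓ = ℓ * 8 + 8 + (timeBound count (1 + ℓ) + 2) + (cellsBound ℓ * fillBound (workspace ℓ) + 1) +
    timeBound (check ψ) (1 + ℓ) + 2

  timeTotal-polynomial : Polynomial timeTotal
  timeTotal-polynomial =
    polynomial-+ (polynomial-+ (polynomial-+ (polynomial-+
      (polynomial-+ (polynomial-* polynomial-id (polynomial-const 8)) (polynomial-const 8))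
      (polynomial-+ (polynomial-∘ (timeBound-polynomial count) 1+n) (polynomial-const 2)))
      (polynomial-+ (polynomial-* cells (polynomial-+
        (polynomial-∘ (timeBound-polynomial (check φ)) (polynomial-+ 1+n cells)) (polynomial-const 8)))
        (polynomial-const 1)))
      (polynomial-∘ (timeBound-polynomial (check ψ)) 1+n)) (polynomial-const 2)
    where
    1+n : Polynomial (1 +_)
    1+n = polynomial-+ (polynomial-const 1) polynomial-id
    cells : Polynomial cellsBound
    cells = polynomial-∘ (valueBound-polynomial count) 1+n

  module _ (w : List Bool) where

    private
      L : ℕ
      L = length w

    answer : Bool
    answer = Semantics.⟦_⟧ L (outputTape w) (check ψ) [] ≡ᵇ 0

    open Correctness base L (inputTape w) code₀ using (computes; same)

    code-at₁ : Code code₀ 12 code₁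
    code-at₁ with _ , _ , _ , _ , _ , _ , _ , _ , _ , _ , _ , _ , c ← code-self code₀ = c

    code-at₂ : Code code₀ (14 + s₁) code₂
    code-at₂ with _ , _ , _ , c ← code-++ (compile count [] 12 2) (length-compile count [] 12 2)
      code-at₁ = c

    code-at₃ : Code code₀ (22 + (s₁ + s₂)) code₃
    code-at₃ with _ , _ , _ , _ , _ , _ , _ , _ , _ , c ← code-++ (compile (check φ) (1 ∷ []) (14 + s₁) 3)
                    (length-compile (check φ) (1 ∷ []) (14 + s₁) 3) code-at₂ = c

    cells : ℕ
    cells = Semantics.⟦_⟧ L (inputTape w) count []

    cells-bounded : cells ≤ cellsBound L × Semantics.duration L (inputTape w) count [] ≤
      timeBound count (1 + L)
    cells-bounded = Bounds.bounded L (inputTape w) count (n≤1+n L)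
      (λ i → ≤-trans (inputTape≤1 w i) (s≤s z≤n)) λ ()

    reading : Σ[ X ∈ Memory ] Reaches (initial w) (L * 8 + 8) ⟨ 12 , X , [] ⟩ ×
                X 0 ≡ L × X 1 ≡ L × (∀ i → X (base + i) ≡ inputTape w i)
    reading with X , run , X0 , _ , Xt ← read-correct w ((λ _ → 0) [ 1 ≔ 1 ]) refl (λ _ _ → refl) =
      (X [ 1 ≔ 0 ]) [ 1 ≔ 0 + X 0 ] ,
      lasting time (tick refl refl ⨟ jump-taken refl refl ⨟ run ⨟ tick refl refl ⨟ tick refl refl) ,
      X0 , X0 , Xt
      where
      time : 2 + (L * 8 + 4 + 2) ≡ L * 8 + 8
      time = solve 1 (λ x → con 2 :+ ((x :+ con 4) :+ con 2) := x :+ con 8) refl (L * 8)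
        where open +-*-Solver

    counting : Σ[ X ∈ Memory ]
      Reaches (initial w) (L * 8 + 8 + (Semantics.duration L (inputTape w) count [] + 2))
        ⟨ 21 + (s₁ + s₂) , X , [] ⟩ ×
        X 0 ≡ L × X 1 ≡ L × X 2 ≡ cells × (∀ i → X (base + i) ≡ inputTape w i)
    counting with X , run , X0 , X1 , Xt ← reading
      with c , f , g , _ ← code-++ (compile count [] 12 2) (length-compile count [] 12 2) code-at₁
      with computes {Y} runY Y2 fr ← Correctness.compile-correct base L (inputTape w) code₀ count
        {[]} {[]} {X = X} {w = []} c
             (record { 0<d = z<s ; in-len = X0 ; in-tape = Xt ; in-var = λ () })
             (+-mono-≤ (m≤m+n 2 4) (m≤m+n (height count) _)) =
      Y [ 3 ≔ 1 ] , (run ⨟ runY ⨟ tick f refl ⨟ jump-taken g refl) ,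
      trans (same fr 0 (inj₁ z<s)) X0 , trans (same fr 1 (inj₁ ≤-refl)) X1 , Y2 ,
      λ i → trans (same fr (base + i) (inj₂ (m≤m+n base i))) (Xt i)

    Filled : Set
    Filled = Σ[ X ∈ Memory ] Σ[ t ∈ ℕ ]
      t ≤ L * 8 + 8 + (timeBound count (1 + L) + 2) + (cellsBound L * fillBound (workspace L) + 1) ×
      Reaches (initial w) t ⟨ 22 + (s₁ + s₂) , X , [] ⟩ ×
      X 0 ≡ L × (∀ i → X (base + i) ≡ outputTape w i) × (∀ i → outputTape w i ≤ 1)

    filling : Filled
    filling = go counting
      where
      go : (Σ[ X ∈ Memory ]
        Reaches (initial w) (L * 8 + 8 + (Semantics.duration L (inputTape w) count [] + 2))
          ⟨ 21 + (s₁ + s₂) , X , [] ⟩ ×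
        X 0 ≡ L × X 1 ≡ L × X 2 ≡ cells × (∀ i → X (base + i) ≡ inputTape w i)) → Filled
      go (X , run , X0 , X1 , X2 , Xt) = finish (fill-correct L cells {B = workspace L} code-at₂
             (m≤n⇒m≤n+o _ (n≤1+n L)) (+-mono-≤ (n≤1+n L) (proj₁ cells-bounded)) (s≤s z≤n)
               (inputTape≤1 w) X0 X1 X2 Xt)
        where
        finish : Fills L cells L (inputTape w) X (workspace L) → Filled
        finish (Y , t , t≤ , runY , Y0 , Yt , Y≤) =
          Y , _ , +-mono-≤ (+-monoʳ-≤ (L * 8 + 8) (+-monoˡ-≤ 2 (proj₂ cells-bounded)))
                    (≤-trans t≤ (+-monoˡ-≤ 1 (*-monoˡ-≤ _ (proj₁ cells-bounded)))) ,
          (run ⨟ runY) , Y0 , Yt , Y≤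

    final-duration : ℕ
    final-duration = Semantics.duration L (outputTape w) (check ψ) []

    final-duration≤ : (∀ i → outputTape w i ≤ 1) → final-duration ≤ timeBound (check ψ) (1 + L)
    final-duration≤ X≤ = proj₂ (Bounds.bounded L (outputTape w) (check ψ) {[]} {1 + L} (n≤1+n L)
      (λ i → ≤-trans (X≤ i) (s≤s z≤n)) λ ())

    run-correct : ∃[ t ] t ≤ timeTotal L × ∀ s → runFor (t + s) code₀ (initial w) ≡ just answer
    run-correct = go filling (code-++ (compile (check ψ) [] (22 + (s₁ + s₂)) 2)
                    (length-compile (check ψ) [] (22 + (s₁ + s₂)) 2) code-at₃)
      where
      pc : ℕ
      pc = 22 + (s₁ + s₂)
      go : Filled → Code code₀ pc (compile (check ψ) [] pc 2) ×
           Code code₀ (pc + s₃) (jump 2 (24 + (s₁ + s₂ + s₃)) ∷ accept ∷ reject ∷ []) →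
           ∃[ t ] t ≤ timeTotal L × ∀ s → runFor (t + s) code₀ (initial w) ≡ just answer
      go (X , t , t≤ , run , X0 , Xt , X≤) (c , f , g , h , _) =
        t + final-duration + 2 , +-monoˡ-≤ 2 (+-mono-≤ t≤ (final-duration≤ X≤)) ,
        finish (Correctness.compile-correct base L (outputTape w) code₀ (check ψ) {[]} {[]} {X = X}
          {w = []} c
          (record { 0<d = z<s ; in-len = X0 ; in-tape = Xt ; in-var = λ () })
          (+-mono-≤ (m≤m+n 2 4) (m≤n⇒m≤o+n (height count) (m≤n+m _ (height (check φ))))))
        where
        finish : Correctness.Computes base L (outputTape w) code₀ [] X pc final-duration (pc + s₃) 2
                   (Semantics.⟦_⟧ L (outputTape w) (check ψ) []) →
                 ∀ s → runFor (t + final-duration + 2 + s) code₀ (initial w) ≡ just answer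
        finish (Correctness.computes runY Y2 _) = concluding (run ⨟ runY) (verdict f g h Y2)

  runFor-within : ∀ w {m} → timeTotal (length w) ≤ m → runFor m code₀ (initial w) ≡ just (answer w)
  runFor-within w {m} total≤m = go (run-correct w)
    where
    go : (∃[ t ] t ≤ timeTotal (length w) × ∀ s → runFor (t + s) code₀ (initial w) ≡ just (answer w)) →
         runFor m code₀ (initial w) ≡ just (answer w)
    go (t , t≤ , run) =
      trans (cong (λ m → runFor m code₀ (initial w)) (sym (m+[n∸m]≡n (≤-trans t≤ total≤m)))) (run (m ∸ t))

  Accepts : List Bool → Set
  Accepts w = [] ⊨ ψ
    where
    open Satisfaction (length w) (outputTape w)

  decides : ∀ (Π : DecisionProblem) →
    (∀ x → Accepts (DecisionProblem.encode Π x) ⇔ DecisionProblem.Yes Π x) → PolynomialTimeDecidable Π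
  decides Π correct = go (standard-form timeTotal-polynomial)
    where
    open DecisionProblem Π
    decide : ∀ x → Dec (Yes x)
    -- Mapping along an equivalence leaves the Boolean of the comparison with 0 unchanged, and this
    -- Boolean is the answer of the program.
    decide x = map (correct x ⇔-∘ check-correct ψ []) (⟦ check ψ ⟧ [] ≟ 0)
      where
      open Satisfaction (length (encode x)) (outputTape (encode x))
      open Semantics (length (encode x)) (outputTape (encode x))
    go : (∃[ c ] ∃[ k ] ∀ n → timeTotal n ≤ c * n ^ k + c) → PolynomialTimeDecidable Π
    go (c , k , bound) = code₀ , c , k , λ x →
      decide x , runFor-within (encode x) (bound (length (encode x)))

-- Evaluation of the criterion

∑<-const : ∀ m c → ∑< m (λ _ → c) ≡ m * c
∑<-const zero    c = refl
∑<-const (suc m) c = cong (c +_) (∑<-const m c)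

∑<-cong : ∀ m {f g} → (∀ i → i < m → f i ≡ g i) → ∑< m f ≡ ∑< m g
∑<-cong zero    eq = refl
∑<-cong (suc m) eq = cong₂ _+_ (eq m ≤-refl) (∑<-cong m (λ i i<m → eq i (m<n⇒m<1+n i<m)))

∑<-indicator : ∀ m {n f} → n ≤ m → (∀ i → i < n → f i ≡ 1) → (∀ i → n ≤ i → i < m → f i ≡ 0) → ∑< m f ≡ n
∑<-indicator zero    z≤n  one zer = refl
∑<-indicator (suc m) n≤1+m one zer with m≤n⇒m<n∨m≡n n≤1+m
... | inj₁ (s≤s n≤m) = cong₂ _+_ (zer m n≤m ≤-refl)
                         (∑<-indicator m n≤m one (λ i n≤i i<m → zer i n≤i (m<n⇒m<1+n i<m)))
... | inj₂ refl      = cong₂ _+_ (one m ≤-refl)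
                         (∑<-indicator m ≤-refl (λ i i<m → one i (m<n⇒m<1+n i<m)) (λ i m≤i i<m →
                           contradiction i<m (≤⇒≯ m≤i)))

stride-< : ∀ {a a′ b b′ n} → a < a′ → b < n → a * n + b < a′ * n + b′
stride-< {a} {a′} {b} {b′} {n} a<a′ b<n = begin-strict
  a * n + b   <⟨ +-monoʳ-< (a * n) b<n ⟩
  a * n + n   ≡⟨ +-comm (a * n) n ⟩
  suc a * n   ≤⟨ *-monoˡ-≤ n a<a′ ⟩
  a′ * n      ≤⟨ m≤m+n (a′ * n) b′ ⟩
  a′ * n + b′ ∎
  where open ≤-Reasoning

stride-injective : ∀ {a a′ b b′ n} → b < n → b′ < n → a * n + b ≡ a′ * n + b′ → a ≡ a′ × b ≡ b′
stride-injective {a} {a′} {b} {b′} {n} b<n b′<n eq with <-cmp a a′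
... | tri< a<a′ _ _  = contradiction eq (<⇒≢ (stride-< a<a′ b<n))
... | tri≈ _ refl _  = refl , +-cancelˡ-≡ (a * n) b b′ eq
... | tri> _ _ a′<a  = contradiction (sym eq) (<⇒≢ (stride-< a′<a b′<n))

bit : Bool → ℕ
bit b = if b then 1 else 0

bit≡1 : ∀ b → (bit b ≡ 1) ⇔ T b
bit≡1 true  = mk⇔ _ (λ _ → refl)
bit≡1 false = mk⇔ (λ ()) (λ ())

symbol-bit : ∀ b w → symbol (b ∷ w) ≡ bit b
symbol-bit true  w = refl
symbol-bit false w = refl

inputTape-++ : ∀ xs ys {l} → length xs ≡ l → ∀ i → inputTape (xs ++ ys) (l + i) ≡ inputTape ys i
inputTape-++ []       ys refl i = refl
inputTape-++ (x ∷ xs) ys refl i = inputTape-++ xs ys refl i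

inputTape-replicate : ∀ m ys i → i < m → inputTape (replicate m true ++ ys) i ≡ 1
inputTape-replicate (suc m) ys zero    _         = refl
inputTape-replicate (suc m) ys (suc i) (s≤s i<m) = inputTape-replicate m ys i i<m

inputTape-tabulate : ∀ {m} (f : Fin m → Bool) ys v → inputTape (tabulate f ++ ys) (toℕ v) ≡ bit (f v)
inputTape-tabulate f ys Fin.zero    = symbol-bit (f Fin.zero) _
inputTape-tabulate f ys (Fin.suc v) = inputTape-tabulate (f ∘ Fin.suc) ys v

inputTape-concat : ∀ {m n} (f : Fin m → Fin n → Bool) ys u v →
                   inputTape (concat (tabulate λ u → tabulate (f u)) ++ ys)
                     (toℕ u * n + toℕ v) ≡ bit (f u v)
inputTape-concat {suc m} {n} f ys u v =
  trans (cong (λ zs → inputTape zs (toℕ u * n + toℕ v)) (++-assoc (tabulate (f Fin.zero)) _ ys)) (row u)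
  where
  rest′ : List Bool
  rest′ = concat (tabulate λ u → tabulate (f (Fin.suc u))) ++ ys
  row : ∀ u → inputTape (tabulate (f Fin.zero) ++ rest′) (toℕ u * n + toℕ v) ≡ bit (f u v)
  row Fin.zero    = inputTape-tabulate (f Fin.zero) rest′ v
  row (Fin.suc u) = trans (cong (inputTape (tabulate (f Fin.zero) ++ rest′))
    (+-assoc n (toℕ u * n) (toℕ v)))
    (trans (inputTape-++ (tabulate (f Fin.zero)) rest′ (length-tabulate (f Fin.zero)) (toℕ u * n + toℕ v))
      (inputTape-concat (f ∘ Fin.suc) ys u v))

inputTape-toList : ∀ {m} (X : Subset m) u → inputTape (Vec.toList X) (toℕ u) ≡ bit (lookup X u)
inputTape-toList (x ∷ X) Fin.zero    = symbol-bit x _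
inputTape-toList (x ∷ X) (Fin.suc u) = inputTape-toList X u

length-concat-tabulate : ∀ m {n} (f : Fin m → Fin n → Bool) →
  length (concat (tabulate λ u → tabulate (f u))) ≡ m * n
length-concat-tabulate zero    f = refl
length-concat-tabulate (suc m) f = trans (length-++ (tabulate (f Fin.zero)))
  (cong₂ _+_ (length-tabulate (f Fin.zero)) (length-concat-tabulate m (f ∘ Fin.suc)))

stride-bounded : ∀ {a m b n} → a < m → b < n → a * n + b < m * n
stride-bounded {a} {m} {b} {n} a<m b<n = subst (a * n + b <_) (+-identityʳ (m * n)) (stride-< a<m b<n)

-- The length of the unary prefix of the input, which is the order of the graph.
order : ∀ {k} → Expr k
order = sum len (lit 1 ⊖ sum (lit 1 ⊕ var Fin.zero) (lit 1 ⊖ cell (var Fin.zero)))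

-- Multiplication by n as repeated addition, since expressions have no product.
times-order : ∀ {k} → Expr k → Expr k
times-order a = sum a order

-- The table follows the input. The length k is the leading digit of the index in base n, so all
-- cells for shorter lengths come earlier.
position : ∀ {k} → Expr k → Expr k → Expr k → Expr k
position k u v = len ⊕ (times-order (times-order k ⊕ u) ⊕ v)

isNear : ∀ {k} → Expr k → Expr k → Expr k → Formula k
isNear k u v = cell (position k u v) ≐ lit 1

-- The added 1 skips the separator between the unary order and the matrix.
isAdjacent : ∀ {k} → Expr k → Expr k → Formula k
isAdjacent u v = cell (order ⊕ (lit 1 ⊕ (times-order u ⊕ v))) ≐ lit 1

isMember : ∀ {k} → Expr k → Formula k
isMember u = cell (order ⊕ (lit 1 ⊕ (times-order order ⊕ u))) ≐ lit 1

#0 : ∀ {k} → Expr (1 + k)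
#0 = var Fin.zero
#1 : ∀ {k} → Expr (2 + k)
#1 = var (Fin.suc Fin.zero)
#2 : ∀ {k} → Expr (3 + k)
#2 = var (Fin.suc (Fin.suc Fin.zero))
#3 : ∀ {k} → Expr (4 + k)
#3 = var (Fin.suc (Fin.suc (Fin.suc Fin.zero)))

distanceCount : Expr 0
distanceCount = times-order (times-order order)
#4 : ∀ {k} → Expr (5 + k)
#4 = var (Fin.suc (Fin.suc (Fin.suc (Fin.suc Fin.zero))))

-- The cell at position k u v tells whether there is a walk of length at
-- most k from u to v.
distanceCell : Formula 1
distanceCell = ex< order (ex< order (ex< order (#3 ≐ position #2 #1 #0 ∧̇
  (#2 ≐ lit 0 ∧̇ #1 ≐ #0 ∨̇
   lit 1 ≼ #2 ∧̇ ex< order ((#2 ≐ #0 ∨̇ isAdjacent #2 #0) ∧̇ isNear (#3 ⊖ lit 1) #0 #1)))))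

isOnGeodesic : ∀ {k} → Formula (3 + k)
isOnGeodesic = all< order (isNear #0 #2 #1 ⇒̇ ex< (lit 1 ⊕ #0)
  (isNear #0 #3 #4 ∧̇ isNear (#1 ⊖ #0) #4 #2))

isThird isGeodetic isSpanned criterion : Formula 0
isThird = ex< order (isMember #0 ∧̇ ex< order (isMember #0 ∧̇ ex< order (isMember #0 ∧̇
  ¬̇ (#2 ≐ #1) ∧̇ ¬̇ (#2 ≐ #0) ∧̇ ¬̇ (#1 ≐ #0))))
isGeodetic = all< order (isMember #0 ∨̇ ex< order
  (isMember #0 ∧̇ ex< order (isMember #0 ∧̇ isOnGeodesic)))
isSpanned = ex< order (isMember #0 ∧̇ ex< order (isMember #0 ∧̇
  all< order (isNear #0 #2 #1 ⇒̇ order ≼ lit 1 ⊕ #0)))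
criterion = all< order (isMember #0) ∨̇ (isThird ∧̇ isGeodetic) ∨̇ isSpanned

open Main distanceCount distanceCell criterion using (filled; outputTape; Accepts; decides)

-- Correctness of the formulas on encoded graphs

module Encoded {n : ℕ} (G : Graph n) (X : Subset n) where

  open Graph G
  open Characterization G X

  w : List Bool
  w = encodeGraphWithSubset G X

  L : ℕ
  L = length w

  tail : List Bool
  tail = concat (tabulate λ u → tabulate λ v → adj u v) ++ Vec.toList X

  L≡ : L ≡ n + suc (n * n + n)
  L≡ = trans (length-++ (replicate n true)) (cong₂ _+_ (length-replicate n) (cong suc
    (trans (length-++ (concat (tabulate λ u → tabulate (adj u))))
      (cong₂ _+_ (length-concat-tabulate n adj) (length-toList X)))))

  input-prefix : ∀ i → i < n → inputTape w i ≡ 1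
  input-prefix = inputTape-replicate n (false ∷ tail)

  input-tail : ∀ i → inputTape w (n + suc i) ≡ inputTape tail i
  input-tail i = inputTape-++ (replicate n true) (false ∷ tail) (length-replicate n) (suc i)

  input-separator : inputTape w n ≡ 0
  input-separator = trans (cong (inputTape w) (sym (+-identityʳ n)))
    (inputTape-++ (replicate n true) (false ∷ tail) (length-replicate n) 0)

  pos : ℕ → ℕ → ℕ → ℕ
  pos k u v = L + ((k * n + u) * n + v)

  module Reading (tape : ℕ → ℕ) (agrees : ∀ i → i < L → tape i ≡ inputTape w i) where

    open Semantics L tape
    open Satisfaction L tape

    n<L : n < L
    n<L = subst (n <_) (sym L≡) (m<m+n n z<s)

    tail<L : ∀ {i} → i < n * n + n → n + suc i < L
    tail<L i< = subst (_ <_) (sym L≡) (+-monoʳ-< n (s≤s i<))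

    -- A position contributes 1 if the cells up to and including it all hold 1, and 0 otherwise. The
    -- separator 0 at position n thus ends the count, whatever follows.
    order-value : ∀ {k} (ρ : Vec ℕ k) → ⟦ order ⟧ ρ ≡ n
    order-value ρ = ∑<-indicator L (<⇒≤ n<L)
      (λ i i<n → cong (1 ∸_) (∑<-zero⁺ (suc i) λ j j≤i → cong (1 ∸_)
        (trans (agrees j (<-trans (<-≤-trans j≤i i<n) n<L)) (input-prefix j (<-≤-trans j≤i i<n)))))
      (λ i n≤i i<L → n≢0⇒1∸n≡0 λ eq →
        1+n≢0 (trans (cong (1 ∸_) (sym (trans (agrees n n<L) input-separator)))
        (∑<-zero⁻ (suc i) {λ j → 1 ∸ tape j} eq n (s≤s n≤i))))

    times-order-value : ∀ {k} (a : Expr k) ρ → ⟦ times-order a ⟧ ρ ≡ ⟦ a ⟧ ρ * n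
    times-order-value a ρ = trans (∑<-cong (⟦ a ⟧ ρ) (λ i _ → order-value (i ∷ ρ))) (∑<-const (⟦ a ⟧ ρ) n)

    position-value : ∀ {k} (a b c : Expr k) ρ → ⟦ position a b c ⟧ ρ ≡ pos (⟦ a ⟧ ρ) (⟦ b ⟧ ρ) (⟦ c ⟧ ρ)
    position-value a b c ρ = cong (λ x → L + (x + ⟦ c ⟧ ρ))
      (trans (times-order-value (times-order a ⊕ b) ρ)
      (cong (λ x → (x + ⟦ b ⟧ ρ) * n) (times-order-value a ρ)))

    isAdjacent-correct : ∀ {k} (a b : Expr k) ρ {u v} → ⟦ a ⟧ ρ ≡ toℕ u → ⟦ b ⟧ ρ ≡ toℕ v →
                         (ρ ⊨ isAdjacent a b) ⇔ Adj u v
    isAdjacent-correct a b ρ {u} {v} a≡ b≡ = subst (λ x → (x ≡ 1) ⇔ Adj u v) (sym value) (bit≡1 (adj u v))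
      where
      value : tape (⟦ order ⊕ (lit 1 ⊕ (times-order a ⊕ b)) ⟧ ρ) ≡ bit (adj u v)
      value = trans (cong tape (cong₂ (λ x y → x + suc y) (order-value ρ)
          (cong₂ _+_ (trans (times-order-value a ρ) (cong (_* n) a≡)) b≡)))
        (trans (agrees _ (tail<L (stride-< (Fin.toℕ<n u) (Fin.toℕ<n v))))
          (trans (input-tail _) (inputTape-concat adj (Vec.toList X) u v)))

    isMember-correct : ∀ {k} (a : Expr k) ρ {u} → ⟦ a ⟧ ρ ≡ toℕ u → (ρ ⊨ isMember a) ⇔ u ∈ X
    isMember-correct a ρ {u} a≡ = subst (λ x → (x ≡ 1) ⇔ u ∈ X) (sym value)
      (mk⇔ (λ eq → lookup⇒[]= u X (T⇒≡ (to (bit≡1 (lookup X u)) eq))) (λ u∈X → cong bit ([]=⇒lookup u∈X)))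
      where
      T⇒≡ : ∀ {b} → T b → b ≡ true
      T⇒≡ {true} _ = refl
      value : tape (⟦ order ⊕ (lit 1 ⊕ (times-order order ⊕ a)) ⟧ ρ) ≡ bit (lookup X u)
      value = trans (cong tape (cong₂ (λ x y → x + suc y) (order-value ρ)
          (cong₂ _+_ (trans (times-order-value order ρ) (cong (_* n) (order-value ρ))) a≡)))
        (trans (agrees _ (tail<L (+-monoʳ-< (n * n) (Fin.toℕ<n u))))
          (trans (input-tail _) (trans (inputTape-++ (concat (tabulate λ u → tabulate (adj u)))
            (Vec.toList X)
            (length-concat-tabulate n adj) (toℕ u)) (inputTape-toList X u))))

    -- `order` is closed, so its value in every environment is this one by computation, and the
    -- quantifier lemmas below apply under any number of variables.
    bound : ℕ
    bound = ⟦ order ⟧ []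

    ex-Fin : ∀ {Q : ℕ → Set} {P : Fin n → Set} → (∀ u → Q (toℕ u) ⇔ P u) →
             (∃[ i ] i < bound × Q i) ⇔ (∃[ u ] P u)
    ex-Fin {Q} eqv = mk⇔
      (λ (i , i< , h) → let i<n = subst (i <_) (order-value []) i< in
        fromℕ< i<n , to (eqv _) (subst Q (sym (Fin.toℕ-fromℕ< i<n)) h))
      (λ (u , p) → toℕ u , subst (toℕ u <_) (sym (order-value [])) (Fin.toℕ<n u) , from (eqv u) p)

    all-ℕ : ∀ {Q P : ℕ → Set} → (∀ i → i < n → Q i ⇔ P i) →
            (∀ i → i < bound → Q i) ⇔ (∀ i → i < n → P i)
    all-ℕ eqv = mk⇔
      (λ h i i<n → to (eqv i i<n) (h i (subst (i <_) (sym (order-value [])) i<n)))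
      (λ h i i< → let i<n = subst (i <_) (order-value []) i< in from (eqv i i<n) (h i i<n))

    all-Fin : ∀ {Q : ℕ → Set} {P : Fin n → Set} → (∀ u → Q (toℕ u) ⇔ P u) →
              (∀ i → i < bound → Q i) ⇔ (∀ u → P u)
    all-Fin {Q} eqv = mk⇔
      (λ h u → to (eqv u) (h (toℕ u) (subst (toℕ u <_) (sym (order-value [])) (Fin.toℕ<n u))))
      (λ h i i< → let i<n = subst (i <_) (order-value []) i< in
        subst Q (Fin.toℕ-fromℕ< i<n) (from (eqv _) (h (fromℕ< i<n))))

    ex-below : ∀ {m} {Q P : ℕ → Set} → (∀ i → i < m → Q i ⇔ P i) →
               (∃[ i ] i < m × Q i) ⇔ (∃[ i ] i < m × P i)
    ex-below eqv = mk⇔ (λ (i , i< , h) → i , i< , to (eqv i i<) h) (λ (i , i< , p) →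
      i , i< , from (eqv i i<) p)

    toℕ-≡ : ∀ {u v : Fin n} → (toℕ u ≡ toℕ v) ⇔ (u ≡ v)
    toℕ-≡ = mk⇔ Fin.toℕ-injective (cong toℕ)

    isNear-correct : ∀ {k} (a b c : Expr k) ρ {P : Set} →
      ((tape (pos (⟦ a ⟧ ρ) (⟦ b ⟧ ρ) (⟦ c ⟧ ρ)) ≡ 1) ⇔ P) → (ρ ⊨ isNear a b c) ⇔ P
    isNear-correct a b c ρ {P} = subst (λ x → (tape x ≡ 1) ⇔ P) (sym (position-value a b c ρ))

    -- The recurrence for k consults only cells for the length k - 1. They have smaller positions
    -- and are correct by hypothesis.
    distanceCell-correct : ∀ {m} →
      (∀ k u v → k < n → pos k (toℕ u) (toℕ v) < m → (tape (pos k (toℕ u) (toℕ v)) ≡ 1) ⇔ Near k u v) →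
      ∀ k u v → k < n → m ≡ pos k (toℕ u) (toℕ v) → (m ∷ [] ⊨ distanceCell) ⇔ Near k u v
    distanceCell-correct {m} below k u v k<n m≡ = mk⇔ forwards backwards
      where
      recurrence : Formula 4
      recurrence = #2 ≐ lit 0 ∧̇ #1 ≐ #0 ∨̇
        lit 1 ≼ #2 ∧̇ ex< order ((#2 ≐ #0 ∨̇ isAdjacent #2 #0) ∧̇ isNear (#3 ⊖ lit 1) #0 #1)

      recurrence-correct : ∀ k → k < n → m ≡ pos k (toℕ u) (toℕ v) →
                           (toℕ v ∷ toℕ u ∷ k ∷ m ∷ [] ⊨ recurrence) ⇔ Near k u v
      recurrence-correct zero _ _ = mk⇔
        (λ { (inj₁ (_ , eq)) → from near-zero (Fin.toℕ-injective eq) ; (inj₂ (() , _)) })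
        (λ h → inj₁ (refl , cong toℕ (to near-zero h)))
      recurrence-correct (suc k) 1+k<n m≡ = mk⇔
        (λ { (inj₁ (() , _)) ; (inj₂ (_ , h)) → from near-suc (to step-correct h) })
        (λ h → inj₂ (s≤s z≤n , from step-correct (to near-suc h)))
        where
        step-correct : (toℕ v ∷ toℕ u ∷ suc k ∷ m ∷ [] ⊨ ex< order
          ((#2 ≐ #0 ∨̇ isAdjacent #2 #0) ∧̇ isNear (#3 ⊖ lit 1) #0 #1)) ⇔
                       (∃[ x ] (u ≡ x ⊎ Adj u x) × Near k x v)
        step-correct = ex-Fin λ x →
            (toℕ-≡ ⊎-⇔ isAdjacent-correct #2 #0 (toℕ x ∷ toℕ v ∷ toℕ u ∷ suc k ∷ m ∷ []) refl refl) ×-⇔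
            isNear-correct (#3 ⊖ lit 1) #0 #1 (toℕ x ∷ toℕ v ∷ toℕ u ∷ suc k ∷ m ∷ [])
              (below k x v (<-trans (n<1+n k) 1+k<n) (subst (_ <_) (sym m≡)
                (+-monoʳ-< L (stride-< (stride-< (n<1+n k) (Fin.toℕ<n x)) (Fin.toℕ<n v)))))

      -- The formula recovers the triple from m by search instead of division. Uniqueness of digits
      -- in base n forces the triple found to be k, u, v.
      forwards : (m ∷ [] ⊨ distanceCell) → Near k u v
      forwards (k′ , _ , u′ , u′< , v′ , v′< , m≡′ , h)
        with a≡ , refl ← stride-injective {k * n + toℕ u} {k′ * n + u′} (Fin.toℕ<n v)
               (subst (v′ <_) (order-value (u′ ∷ k′ ∷ m ∷ [])) v′<)
               (+-cancelˡ-≡ L _ _ (trans (sym m≡)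
                 (trans m≡′ (position-value #2 #1 #0 (v′ ∷ u′ ∷ k′ ∷ m ∷ [])))))
        with refl , refl ← stride-injective {k} {k′} (Fin.toℕ<n u)
          (subst (u′ <_) (order-value (k′ ∷ m ∷ [])) u′<) a≡ =
        to (recurrence-correct k k<n m≡) h

      backwards : Near k u v → m ∷ [] ⊨ distanceCell
      backwards h = k , subst (k <_) (sym (order-value (m ∷ []))) k<n ,
        toℕ u , subst (toℕ u <_) (sym (order-value (k ∷ m ∷ []))) (Fin.toℕ<n u) ,
        toℕ v , subst (toℕ v <_) (sym (order-value (toℕ u ∷ k ∷ m ∷ []))) (Fin.toℕ<n v) ,
        trans m≡ (sym (position-value #2 #1 #0 (toℕ v ∷ toℕ u ∷ k ∷ m ∷ []))) ,
        from (recurrence-correct k k<n m≡) h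

    module _ (near-cells : ∀ k u v → k < n → (tape (pos k (toℕ u) (toℕ v)) ≡ 1) ⇔ Near k u v) where

      isOnGeodesic-correct : ∀ u x v → (toℕ v ∷ toℕ u ∷ toℕ x ∷ [] ⊨ isOnGeodesic) ⇔ OnGeodesic u x v
      isOnGeodesic-correct u x v = all-ℕ λ k k<n → →-cong-⇔
        (isNear-correct #0 #2 #1 (k ∷ toℕ v ∷ toℕ u ∷ toℕ x ∷ []) (near-cells k u v k<n))
        (ex-below λ i i≤k →
          isNear-correct #0 #3 #4 (i ∷ k ∷ toℕ v ∷ toℕ u ∷ toℕ x ∷ [])
            (near-cells i u x (≤-<-trans (s≤s⁻¹ i≤k) k<n)) ×-⇔
          isNear-correct (#1 ⊖ #0) #4 #2 (i ∷ k ∷ toℕ v ∷ toℕ u ∷ toℕ x ∷ [])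
            (near-cells (k ∸ i) x v (≤-<-trans (m∸n≤m k i) k<n)))

      isThird-correct : ([] ⊨ isThird) ⇔ Third
      isThird-correct = ex-Fin λ a → isMember-correct #0 (toℕ a ∷ []) refl ×-⇔
        ex-Fin λ b → isMember-correct #0 (toℕ b ∷ toℕ a ∷ []) refl ×-⇔
        ex-Fin λ c → isMember-correct #0 (toℕ c ∷ toℕ b ∷ toℕ a ∷ []) refl ×-⇔
          ¬-cong-⇔ toℕ-≡ ×-⇔ ¬-cong-⇔ toℕ-≡ ×-⇔ ¬-cong-⇔ toℕ-≡

      isGeodetic-correct : ([] ⊨ isGeodetic) ⇔ (∀ x → x ∈ X ⊎ Between x)
      isGeodetic-correct = all-Fin λ x → isMember-correct #0 (toℕ x ∷ []) refl ⊎-⇔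
        ex-Fin λ u → isMember-correct #0 (toℕ u ∷ toℕ x ∷ []) refl ×-⇔
        ex-Fin λ v → isMember-correct #0 (toℕ v ∷ toℕ u ∷ toℕ x ∷ []) refl ×-⇔
          isOnGeodesic-correct u x v

      isSpanned-correct : ([] ⊨ isSpanned) ⇔ (∃[ u ] u ∈ X × ∃[ v ] v ∈ X × Spanned u v)
      isSpanned-correct = ex-Fin λ u → isMember-correct #0 (toℕ u ∷ []) refl ×-⇔
        ex-Fin λ v → isMember-correct #0 (toℕ v ∷ toℕ u ∷ []) refl ×-⇔
        all-ℕ λ k k<n → →-cong-⇔
          (isNear-correct #0 #2 #1 (k ∷ toℕ v ∷ toℕ u ∷ []) (near-cells k u v k<n))
          (subst (λ x → (x ≤ suc k) ⇔ (n ≤ suc k)) (sym (order-value (k ∷ toℕ v ∷ toℕ u ∷ [])))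
            (mk⇔ id id))

      criterion-correct : ([] ⊨ criterion) ⇔ Criterion
      criterion-correct = all-Fin (λ x → isMember-correct #0 (toℕ x ∷ []) refl) ⊎-⇔
        (isThird-correct ×-⇔ isGeodetic-correct) ⊎-⇔ isSpanned-correct

  -- Here m is the position of the next cell to be filled.
  Invariant : ℕ → (ℕ → ℕ) → Set
  Invariant m tape = (∀ i → i < L → tape i ≡ inputTape w i) ×
    (∀ k u v → k < n → pos k (toℕ u) (toℕ v) < m → (tape (pos k (toℕ u) (toℕ v)) ≡ 1) ⇔ Near k u v)

  1∸n≡1 : ∀ x → (1 ∸ x ≡ 1) ⇔ (x ≡ 0)
  1∸n≡1 zero    = mk⇔ (λ _ → refl) (λ _ → refl)
  1∸n≡1 (suc x) = mk⇔ (λ eq → contradiction (trans (sym (0∸n≡0 x)) eq) λ ()) λ ()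

  invariant-step : ∀ {m tape} → L ≤ m → Invariant m tape →
    Invariant (suc m) (tape [ m ≔ 1 ∸ Semantics.⟦_⟧ L tape (check distanceCell) (m ∷ []) ])
  invariant-step {m} {tape} L≤m (agrees , below) =
    (λ i i<L → trans ([≔]-other tape value (<⇒≢ (<-≤-trans i<L L≤m))) (agrees i i<L)) ,
    λ k u v k<n p<1+m → cases k u v k<n (m≤n⇒m<n∨m≡n p<1+m)
    where
    open Reading tape agrees
    open Satisfaction L tape
    value : ℕ
    value = 1 ∸ Semantics.⟦_⟧ L tape (check distanceCell) (m ∷ [])
    cases : ∀ k u v → k < n → suc (pos k (toℕ u) (toℕ v)) < suc m ⊎ suc (pos k (toℕ u) (toℕ v)) ≡ suc m →
            ((tape [ m ≔ value ]) (pos k (toℕ u) (toℕ v)) ≡ 1) ⇔ Near k u v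
    cases k u v k<n (inj₁ (s≤s p<m)) = subst (λ x → (x ≡ 1) ⇔ Near k u v)
      (sym ([≔]-other tape value (<⇒≢ p<m))) (below k u v k<n p<m)
    cases k u v k<n (inj₂ eq) = subst (λ x → (x ≡ 1) ⇔ Near k u v)
      (sym (trans (cong (tape [ m ≔ value ]) (suc-injective eq)) ([≔]-same tape m value)))
      (distanceCell-correct below k u v k<n
        (sym (suc-injective eq)) ⇔-∘ (check-correct distanceCell (m ∷ []) ⇔-∘ 1∸n≡1 _))

  invariant-filled : ∀ c {m tape} → L ≤ m → Invariant m tape → Invariant (m + c) (filled L c m tape)
  invariant-filled zero    {m} {tape} L≤m inv = subst (λ m → Invariant m tape) (sym (+-identityʳ m)) inv
  invariant-filled (suc c) {m} {tape} L≤m inv =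
    subst (λ m′ → Invariant m′ (filled L (suc c) m tape)) (sym (+-suc m c))
    (invariant-filled c (m≤n⇒m≤1+n L≤m) (invariant-step L≤m inv))

  output-invariant : Invariant (L + n * n * n) (outputTape w)
  output-invariant = subst (λ c → Invariant (L + c) (outputTape w)) count≡
    (invariant-filled (Semantics.⟦_⟧ L (inputTape w) distanceCount []) ≤-refl
      ((λ _ _ → refl) , λ k u v _ p<L → contradiction p<L (≤⇒≯ (m≤m+n L _))))
    where
    open Reading (inputTape w) (λ _ _ → refl)
    count≡ : Semantics.⟦_⟧ L (inputTape w) distanceCount [] ≡ n * n * n
    count≡ = trans (times-order-value (times-order order) [])
      (cong (_* n) (trans (times-order-value order []) (cong (_* n) (order-value []))))

  accepts⇔criterion : Accepts w ⇔ Criterion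
  accepts⇔criterion = Reading.criterion-correct (outputTape w) (proj₁ output-invariant)
    λ k u v k<n → proj₂ output-invariant k u v k<n
      (+-monoʳ-< L (stride-bounded (stride-bounded k<n (Fin.toℕ<n u)) (Fin.toℕ<n v)))

  accepts⇔strong : IsCactus G → Accepts w ⇔ IsStrongGeodetic G X
  accepts⇔strong cactus = mk⇔ (criterion⇒strong cactus) (strong⇒criterion cactus) ⇔-∘ accepts⇔criterion

corollary13 : PolynomialTimeDecidable StrongGeodeticRecognitionOnCacti
corollary13 = decides StrongGeodeticRecognitionOnCacti λ x →
  Encoded.accepts⇔strong (CactusWithSubset.graph x) (CactusWithSubset.subset x) (CactusWithSubset.cactus x)
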